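{- Let $c(n)$ be the number of toothpicks added at stage $n$ of the corner toothpick structure, $t(n)$ the number added at stage $n$ of the toothpick structure, and $T(n)=\sum_{i=0}^n t(i)$, with $c(0)=t(0)=0$. Then, as formal power series, $$ \sum_{n\ge0}c(n)x^n = x(1+x)\prod_{k\ge1}\left(1+x^{2^k-1}+2x^{2^k}\right), $$ $$ \sum_{n\ge0}t(n)x^n=\frac{x}{1+2x}\Big\{1+4x(1+x)\prod_{k\ge1}\left(1+x^{2^k-1}+2x^{2^k}\right)\Big\}=\frac{x}{1+2x}\Big\{1+2x\prod_{k\ge0}\left(1+x^{2^k-1}+2x^{2^k}\right)\Big\}, $$ and $$ \sum_{n\ge0}T(n)x^n=\frac{x}{(1-x)(1+2x)}\Big\{1+2x\prod_{k\ge0}\left(1+x^{2^k-1}+2x^{2^k}\right)\Big\}. $$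
   Context: A toothpick is a line segment of length $1$ in the plane. An end of a toothpick is exposed if that point is neither an end nor the midpoint of any other toothpick (or half-toothpick) in the structure. The toothpick structure: at stage $1$ place a single toothpick from $(0,-\tfrac12)$ to $(0,\tfrac12)$; at each subsequent stage, for every exposed toothpick end, place a toothpick centered at that end and perpendicular to the toothpick having that end. The corner toothpick structure: no toothpick may cross into the third quadrant $\{x<0,y<0\}$, and toothpicks may touch the negative $x$- or $y$-axis only at their ends; at stage $0$ place a half-toothpick from $(0,0)$ to $(\tfrac12,0)$; at each stage $n\ge1$, for every exposed end, place a perpendicular toothpick centered at that end whenever this respects the restrictions. -}

module Defs where

open import Data.Nat as ℕ using (ℕ; zero; suc; _∸_; _^_; _≤_)
open import Data.Integer as ℤ using (ℤ; +_; -_)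
open import Data.Bool using (Bool; true; false; _∧_; _∨_; not; if_then_else_)
open import Data.List using (List; []; _∷_; _++_; map; length; [_])
open import Data.Product using (_×_; _,_; ∃)
open import Relation.Nullary using (does)
open import Relation.Binary.PropositionalEquality using (_≡_)

-- Geometry.  All coordinates are measured in units of 1/2, so every
-- point occurring in the structures has integer coordinates; a toothpick
-- has length 2 in these units and the half-toothpick has length 1.
-- Scaling by 2 preserves all notions involved (ends, midpoints,
-- perpendicularity, the sign conditions defining quadrants/half-axes).

Point : Set
Point = ℤ × ℤ

infix 4 _==ℤ_ _<ℤ_

_==ℤ_ : ℤ → ℤ → Bool
a ==ℤ b = does (a ℤ.≟ b)

_<ℤ_ : ℤ → ℤ → Bool
a <ℤ b = does (a ℤ.<? b)

-- A (closed, axis-parallel) segment given by its two ends.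
record Seg : Set where
  constructor seg
  field
    end₁ : Point
    end₂ : Point

vert : Point → Seg
vert (x , y) = seg (x , y ℤ.- + 1) (x , y ℤ.+ + 1)

horiz : Point → Seg
horiz (x , y) = seg (x ℤ.- + 1 , y) (x ℤ.+ + 1 , y)

isVertical : Seg → Bool
isVertical (seg (ax , _) (bx , _)) = ax ==ℤ bx

perpAt : Point → Seg → Seg
perpAt p s = if isVertical s then horiz p else vert p

touches : Point → Seg → Bool
touches (px , py) (seg (ax , ay) (bx , by)) =
  ((px ==ℤ ax) ∧ (py ==ℤ ay)) ∨ ((px ==ℤ bx) ∧ (py ==ℤ by))
  ∨ (((+ 2 ℤ.* px) ==ℤ (ax ℤ.+ bx)) ∧ ((+ 2 ℤ.* py) ==ℤ (ay ℤ.+ by)))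

touchesNone : List Seg → Point → Bool
touchesNone [] p = true
touchesNone (s ∷ ss) p = not (touches p s) ∧ touchesNone ss p

keep : {A : Set} → (A → Bool) → List A → List A
keep f [] = []
keep f (x ∷ xs) = if f x then x ∷ keep f xs else keep f xs

endsOf : Seg → List Point
endsOf (seg a b) = a ∷ b ∷ []

exposedGo : List Seg → List Seg → List (Point × Seg)
exposedGo pre [] = []
exposedGo pre (s ∷ suf) =
  map (λ p → p , s) (keep (touchesNone (pre ++ suf)) (endsOf s))
  ++ exposedGo (pre ++ [ s ]) suf

exposedEnds : List Seg → List (Point × Seg)
exposedEnds = exposedGo []

newPicks : List Seg → List Seg
newPicks L = map (λ { (p , s) → perpAt p s }) (exposedEnds L)

tStruct : ℕ → List Seg
tStruct zero = []
tStruct (suc zero) = [ vert (+ 0 , + 0) ]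
tStruct (suc (suc n)) = tStruct (suc n) ++ newPicks (tStruct (suc n))

t : ℕ → ℕ
t zero = 0
t (suc zero) = 1
t (suc (suc n)) = length (newPicks (tStruct (suc n)))

T : ℕ → ℕ
T zero = t zero
T (suc n) = T n ℕ.+ t (suc n)

minℤ maxℤ : ℤ → ℤ → ℤ
minℤ = ℤ._⊓_
maxℤ = ℤ._⊔_

-- s contains a point with x < 0 and y < 0.  (s is the box
-- [min x, max x] × [min y, max y].)
crossesQ3 : Seg → Bool
crossesQ3 (seg (ax , ay) (bx , by)) =
  (minℤ ax bx <ℤ + 0) ∧ (minℤ ay by <ℤ + 0)

-- s meets the negative x-axis {(x,0) : x < 0} in a point that is not an
-- end of s.  Horizontal s at height h with x-range [m,M] (m<M): the
-- non-end points with x<0 on the line form (m, min(M,0)), nonempty iff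
-- m < 0, so the condition is h = 0 and m < 0.  Vertical s at abscissa v
-- with y-range [m,M]: it meets y=0 only at (v,0), a non-end point iff
-- m < 0 < M, lying on the negative x-axis iff v < 0.
badNegX : Seg → Bool
badNegX s@(seg (ax , ay) (bx , by)) =
  if isVertical s
  then (ax <ℤ + 0) ∧ (minℤ ay by <ℤ + 0) ∧ (+ 0 <ℤ maxℤ ay by)
  else (ay ==ℤ + 0) ∧ (minℤ ax bx <ℤ + 0)

badNegY : Seg → Bool
badNegY s@(seg (ax , ay) (bx , by)) =
  if isVertical s
  then (ax ==ℤ + 0) ∧ (minℤ ay by <ℤ + 0)
  else (ay <ℤ + 0) ∧ (minℤ ax bx <ℤ + 0) ∧ (+ 0 <ℤ maxℤ ax bx)

respects : Seg → Bool
respects s = not (crossesQ3 s) ∧ not (badNegX s) ∧ not (badNegY s)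

newCorner : List Seg → List Seg
newCorner L = keep respects (newPicks L)

-- structure after stage n; stage 0 is the half-toothpick (0,0)–(1/2,0)
cStruct : ℕ → List Seg
cStruct zero = [ seg (+ 0 , + 0) (+ 1 , + 0) ]
cStruct (suc n) = cStruct n ++ newCorner (cStruct n)

c : ℕ → ℕ
c zero = 0
c (suc n) = length (newCorner (cStruct n))

Series : Set
Series = ℕ → ℤ

_≐_ : Series → Series → Set
f ≐ g = ∀ n → f n ≡ g n

infix 4 _≐_
infixl 6 _⊕_ _⊖_
infixl 7 _⊛_

sumTo : (ℕ → ℤ) → ℕ → ℤ
sumTo f zero = f zero
sumTo f (suc n) = sumTo f n ℤ.+ f (suc n)

_⊕_ : Series → Series → Series
(f ⊕ g) n = f n ℤ.+ g n

_⊖_ : Series → Series → Series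
(f ⊖ g) n = f n ℤ.- g n

_⊛_ : Series → Series → Series
(f ⊛ g) n = sumTo (λ i → f i ℤ.* g (n ∸ i)) n

mono : ℤ → ℕ → Series
mono a e n = if does (n ℕ.≟ e) then a else + 0

𝟙 : Series
𝟙 = mono (+ 1) 0

X : Series
X = mono (+ 1) 1

prodRange : (ℕ → Series) → ℕ → ℕ → Series
prodRange F a zero = 𝟙
prodRange F a (suc m) = prodRange F a m ⊛ F (a ℕ.+ m)

-- P = ∏_{k ≥ a} F k as a formal power series (x-adic limit): every
-- coefficient of the partial products is eventually equal to that of P.
IsInfProd : (ℕ → Series) → ℕ → Series → Set
IsInfProd F a P = ∀ n → ∃ λ M → ∀ m → M ≤ m → prodRange F a m n ≡ P n

factor : ℕ → Series
factor k = 𝟙 ⊕ mono (+ 1) (2 ^ k ∸ 1) ⊕ mono (+ 2) (2 ^ k)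

cGF tGF TGF : Series
cGF n = + c n
tGF n = + t n
TGF n = + T n

-- A toothpick is determined by its centre, since the parity of the centre
-- decides its direction; a structure is therefore a function giving the
-- arrival time of each lattice point.  A point has two possible parents, its
-- neighbours across the direction of its toothpick, and it is reached one step
-- after the earlier parent, or never if the two parents arrive together.
-- One quadrant of the toothpick structure satisfies this rule through a
-- self-similar pattern: with a = 2^k, the last toothpick of the block
-- 0 < x < a, 0 < y ≤ a arrives at time 2a − 2 at (a − 1, a), and from (a , a) a
-- new corner structure starts, three quadrants of which are copies of the
-- block up to symmetry.  If N_k counts the block and W_k the corner structure
-- built from it, then W_k = 1 + x + (1 + 2x) N_k and
-- N_(k+1) = N_k + x^(2a−1) W_k, so that W_(k+1) = W_k (1 + x^(2a−1) + 2 x^(2a)).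
-- In the limit the corner structure is x W, and four quadrants around the first
-- toothpick give x (1 + 2x + 4x N).
module Submission where

open import Defs
open import Algebra using (CommutativeSemiring)
import Algebra.Properties.AbelianGroup as AbelianGroupₚ
import Algebra.Solver.Ring.NaturalCoefficients.Default as SemiringSolver
import Algebra.Structures.Biased as Biased
open import Data.Bool using (Bool; true; false; not; _xor_; _∧_; _∨_; if_then_else_)
open import Data.Bool.Properties
  using (not-injective; not-involutive; xor-identityʳ; ∨-zeroʳ; ∧-conicalˡ; ∧-conicalʳ; ¬-not; not-distribˡ-xor; not-distribʳ-xor)
open import Data.Empty using (⊥; ⊥-elim)
open import Data.Integer using (+_)
open import Data.Integer as ℤ using (ℤ; -[1+_]; ∣_∣) renaming (_⊖_ to _⊝_)
open import Data.Integer.Properties as ℤₚ using ([1+m]⊖[1+n]≡m⊖n)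
open import Data.Integer.Tactic.RingSolver using (solve-∀)
open import Data.List using (List; []; _∷_; [_]; _++_; map; length)
open import Data.List.Membership.Propositional using (_∈_; _∉_)
open import Data.List.Membership.Propositional.Properties using (∈-++⁺ˡ; ∈-++⁺ʳ; ∈-++⁻; ∈-map⁺; ∈-map⁻; ∈-∃++)
open import Data.List.Properties using (length-++; length-map; ++-assoc; map-++)
open import Data.List.Relation.Unary.All as All using ([]; _∷_)
open import Data.List.Relation.Unary.AllPairs using ([]; _∷_)
open import Data.List.Relation.Unary.Any using (here; there)
open import Data.List.Relation.Unary.Unique.Propositional using (Unique)
import Data.List.Relation.Unary.Unique.Propositional.Properties as Uniqueₚ
open import Data.Maybe as Maybe using (Maybe; just; nothing)
open import Data.Maybe.Properties using (map-∘; map-id)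
open import Data.Nat as ℕ using (ℕ; zero; suc; _+_; _∸_; _^_; _≤_; _<_; z≤n; s≤s; pred)
open import Data.Nat.Properties as ℕₚ
open import Data.Product using (Σ; _×_; _,_; ∃; proj₁; proj₂)
open import Data.Sum using (_⊎_; inj₁; inj₂; [_,_]′)
open import Data.Sum.Properties using (inj₁-injective; inj₂-injective)
open import Data.Unit using (⊤; tt)
open import Function using (_∘_; case_of_)
open import Level using (0ℓ)
open import Relation.Binary using (IsEquivalence; tri<; tri≈; tri>)
open import Relation.Binary.PropositionalEquality hiding ([_])
open import Relation.Nullary using (¬_; does; yes; no)
open import Relation.Nullary.Decidable using (dec-true; dec-false)

open AbelianGroupₚ ℤₚ.+-0-abelianGroup using (∙-cancelʳ)
open ≡-Reasoning

-- The delicate point is the seam between a block and the corner structure attached at (a , a),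
-- where the parents of a point may belong to different sides. Along the last column x = a - 1 and
-- the top row y = a of the block, odd positions are filled and even ones empty. A filled edge point
-- has a time of at most 2a - 2, while every new point arrives at 2a - 1 or later, so a new
-- neighbour cannot change it. A new point with an old parent across the seam always faces an empty
-- position, except for (a , a), whose parent is the last toothpick of the block.
--
-- The ray to the right of a new centre stays empty for another reason: the parents of its points
-- lie in an upright and in a turned copy, and they tie because column 1 of the pattern repeats row
-- 1 one step later. This relation is carried through the induction along with the rule.
--
-- The turned copy runs one step ahead of the two upright ones, whence the coefficient 1 + 2x of N.
-- The denominator 1 + 2x of the toothpick series comes from eliminating N between its expression
-- and that of W.

private variable
  A B : Set

-- Arrival times and the two-parent rule.

par : ℕ → Bool
par zero    = false
par (suc n) = not (par n)

clash : ℕ → ℕ → Maybe ℕ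
clash zero    zero    = nothing
clash zero    (suc _) = just 1
clash (suc _) zero    = just 1
clash (suc m) (suc n) = Maybe.map suc (clash m n)

-- p ▵ q is the arrival time of a point whose parents arrive at p and q, where
-- nothing means never.
infixl 6 _▵_
infixr 7 _+ₜ_

_▵_ : Maybe ℕ → Maybe ℕ → Maybe ℕ
just m  ▵ just n  = clash m n
just m  ▵ nothing = just (suc m)
nothing ▵ just n  = just (suc n)
nothing ▵ nothing = nothing

_+ₜ_ : ℕ → Maybe ℕ → Maybe ℕ
s +ₜ p = Maybe.map (s ℕ.+_) p

clash-comm : ∀ m n → clash m n ≡ clash n m
clash-comm zero    zero    = refl
clash-comm zero    (suc n) = refl
clash-comm (suc m) zero    = refl
clash-comm (suc m) (suc n) = cong (Maybe.map suc) (clash-comm m n)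

▵-comm : ∀ p q → p ▵ q ≡ q ▵ p
▵-comm (just m) (just n) = clash-comm m n
▵-comm (just m) nothing  = refl
▵-comm nothing  (just n) = refl
▵-comm nothing  nothing  = refl

clash-diag : ∀ m → clash m m ≡ nothing
clash-diag zero    = refl
clash-diag (suc m) = cong (Maybe.map suc) (clash-diag m)

▵-diag : ∀ p → p ▵ p ≡ nothing
▵-diag (just m) = clash-diag m
▵-diag nothing  = refl

clash-< : ∀ {m n} → m < n → clash m n ≡ just (suc m)
clash-< {zero}  {suc n} _         = refl
clash-< {suc m} {suc n} (s≤s m<n) = cong (Maybe.map suc) (clash-< m<n)

_later-than_ : Maybe ℕ → ℕ → Set
p later-than m = ∀ n → p ≡ just n → m < n

▵-later : ∀ {m} p → p later-than m → just m ▵ p ≡ just (suc m)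
▵-later (just n) later = clash-< (later n refl)
▵-later nothing  later = refl

clash-shift : ∀ s m n → clash (s + m) (s + n) ≡ s +ₜ clash m n
clash-shift zero    m n = sym (map-id (clash m n))
clash-shift (suc s) m n =
  trans (cong (Maybe.map suc) (clash-shift s m n)) (sym (map-∘ (clash m n)))

+ₜ-▵ : ∀ s p q → s +ₜ (p ▵ q) ≡ s +ₜ p ▵ s +ₜ q
+ₜ-▵ s (just m) (just n) = sym (clash-shift s m n)
+ₜ-▵ s (just m) nothing  = cong just (+-suc s m)
+ₜ-▵ s nothing  (just n) = cong just (+-suc s n)
+ₜ-▵ s nothing  nothing  = refl

-- Patterns in a quadrant and their self-similar growth.

Pattern : Set
Pattern = ℕ → ℕ → Maybe ℕ

-- Arrival times at distances x and y from the centre of a vertical toothpick that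
-- arrives at time 0, when every quadrant around it follows u.
spread : Pattern → Pattern
spread u zero    zero          = just 0
spread u zero    (suc zero)    = just 1
spread u zero    (suc (suc _)) = nothing
spread u (suc x) zero          = nothing
spread u (suc x) (suc y)       = 1 +ₜ u (suc x) (suc y)

-- Arrival times around a vertical toothpick whose third quadrant stays empty.  In
-- the fourth quadrant u appears turned by a right angle, one point closer and one
-- step earlier than above.
corner : Pattern → ℤ → ℤ → Maybe ℕ
corner u i        (+ y)    = spread u ∣ i ∣ y
corner u (+ x)    -[1+ y ] = u (suc y) (suc x)
corner u -[1+ _ ] -[1+ _ ] = nothing

glue : {A : Set} → A → A → ℤ → ℤ → A
glue old new _        (+ suc _) = new
glue old new (+ _)    (+ zero)  = new
glue old new -[1+ _ ] (+ zero)  = old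
glue old new (+ _)    -[1+ _ ]  = new
glue old new -[1+ _ ] -[1+ _ ]  = old

-- The block x < a, y ≤ a keeps u; the rest is a corner structure around (a , a).
grow : ℕ → Pattern → Pattern
grow a u x y = glue (u x y) (pred (a + a) +ₜ corner u (x ⊝ a) (y ⊝ a)) (x ⊝ a) (y ⊝ a)

quad : ℕ → Pattern
quad zero    x y = nothing
quad (suc k) = grow (2 ^ k) (quad k)

-- The names `horizontal` and `vertical` refer to the direction in which the parents lie. The point
-- (1 , 1) is exempt from the rule because its first parent sits on the axis, outside the pattern;
-- `start` supplies its time. `mirror` is the tie that keeps the ray to the right of a corner centre
-- empty.
record Lawful (A : ℕ) (u : Pattern) : Set where
  field
    left       : ∀ y → u 0 y ≡ nothing
    bottom     : ∀ x → u x 0 ≡ nothing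
    positive   : ∀ x y → u x y ≢ just 0
    start      : u 1 1 ≡ just 1
    mirror     : ∀ y → u 1 (2 + y) ≡ 1 +ₜ u (1 + y) 1
    horizontal : ∀ x y → suc x < A → suc y ≤ A → par x ≡ par y → ¬ (x ≡ 0 × y ≡ 0) →
                 u (suc x) (suc y) ≡ u x (suc y) ▵ u (2 + x) (suc y)
    vertical   : ∀ x y → suc x < A → suc y ≤ A → par x ≡ not (par y) →
                 u (suc x) (suc y) ≡ u (suc x) y ▵ u (suc x) (2 + y)

-- A function of the distance from an axis is symmetric about it. On the axis both neighbours
-- coincide and tie, so a point with parents across the axis must be empty; off the axis the
-- one-sided rule applies, with the parents swapped on the negative side.
around : ∀ (F : ℕ → Maybe ℕ) i → (∣ i ∣ ≡ 0 → F 0 ≡ nothing) →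
         (∀ n → ∣ i ∣ ≡ suc n → F (suc n) ≡ F n ▵ F (2 + n)) →
         F ∣ i ∣ ≡ F ∣ ℤ.pred i ∣ ▵ F ∣ ℤ.suc i ∣
around F (+ zero)  z s = trans (z refl) (sym (▵-diag (F 1)))
around F (+ suc n) z s = s n refl
around F -[1+ zero ] z s = trans (s 0 refl) (▵-comm (F 0) (F 2))
around F -[1+ suc n ] z s = trans (s (suc n) refl) (▵-comm (F (suc n)) (F (3 + n)))

not-swap : ∀ {b c} → b ≡ not c → c ≡ not b
not-swap {c = c} refl = sym (not-involutive c)

par-pred∣∣ : ∀ i → par ∣ ℤ.pred i ∣ ≡ not (par ∣ i ∣)
par-pred∣∣ (+ zero)  = refl
par-pred∣∣ (+ suc n) = sym (not-involutive (par n))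
par-pred∣∣ -[1+ n ]  = refl

⊝-suc : ∀ m n → suc m ⊝ n ≡ ℤ.suc (m ⊝ n)
⊝-suc m       zero          = refl
⊝-suc zero    (suc zero)    = refl
⊝-suc zero    (suc (suc n)) = refl
⊝-suc (suc m) (suc n) = begin
  suc (suc m) ⊝ suc n   ≡⟨ [1+m]⊖[1+n]≡m⊖n (suc m) n ⟩
  suc m ⊝ n             ≡⟨ ⊝-suc m n ⟩
  ℤ.suc (m ⊝ n)         ≡⟨ cong ℤ.suc ([1+m]⊖[1+n]≡m⊖n m n) ⟨
  ℤ.suc (suc m ⊝ suc n) ∎

⊝-pred : ∀ m n → m ⊝ n ≡ ℤ.pred (suc m ⊝ n)
⊝-pred m n = trans (sym (ℤₚ.pred-suc (m ⊝ n))) (cong ℤ.pred (sym (⊝-suc m n)))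

⊝≡+⇒ : ∀ m n {k} → m ⊝ n ≡ + k → m ≡ n + k
⊝≡+⇒ m       zero    refl = refl
⊝≡+⇒ zero    (suc n) ()
⊝≡+⇒ (suc m) (suc n) e = cong suc (⊝≡+⇒ m n (trans (sym ([1+m]⊖[1+n]≡m⊖n m n)) e))

⊝≡-⇒ : ∀ m n {k} → m ⊝ n ≡ -[1+ k ] → m + suc k ≡ n
⊝≡-⇒ m       zero    ()
⊝≡-⇒ zero    (suc n) refl = refl
⊝≡-⇒ (suc m) (suc n) e = cong suc (⊝≡-⇒ m n (trans (sym ([1+m]⊖[1+n]≡m⊖n m n)) e))

par-⊝ : ∀ m n → par ∣ m ⊝ n ∣ ≡ par m xor par n
par-⊝ zero    zero    = refl
par-⊝ zero    (suc n) = refl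
par-⊝ (suc m) zero    = lemma (par m)
  where
  lemma : ∀ b → not b ≡ not b xor false
  lemma false = refl
  lemma true  = refl
par-⊝ (suc m) (suc n) =
  trans (cong (λ i → par ∣ i ∣) ([1+m]⊖[1+n]≡m⊖n m n)) (trans (par-⊝ m n) (lemma (par m) (par n)))
  where
  lemma : ∀ b c → b xor c ≡ not b xor not c
  lemma false c = sym (not-involutive c)
  lemma true  c = refl

-- The rule around a full centre and around a corner centre.

module _ {A : ℕ} {u : Pattern} (L : Lawful A u) where
  open Lawful L

  spread-horizontal : ∀ x y → suc x < A → y ≤ A → par (suc x) ≡ par y →
    spread u (suc x) y ≡ spread u x y ▵ spread u (2 + x) y
  spread-horizontal (suc x) zero          _ _ _ = refl
  -- The left parent is the end of the central toothpick, at time 1. It wins because the right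
  -- parent arrives at 2 or later, `u 2 1` not being `just 0`.
  spread-horizontal zero    (suc zero)    _ _ _ rewrite start with u 2 1 in e
  ... | just zero    = ⊥-elim (positive 2 1 e)
  ... | just (suc n) = refl
  ... | nothing      = refl
  spread-horizontal zero    (suc (suc y)) x< y≤ p
    rewrite horizontal 0 (suc y) x< y≤ (not-injective p) (λ ()) | left (2 + y) =
    +ₜ-▵ 1 nothing (u 2 (2 + y))
  spread-horizontal (suc x) (suc y) x< y≤ p
    rewrite horizontal (suc x) y x< y≤ (not-injective p) (λ ()) =
    +ₜ-▵ 1 (u (suc x) (suc y)) (u (3 + x) (suc y))

  spread-vertical : ∀ x y → x < A → suc y ≤ A → par (suc y) ≡ not (par x) →
    spread u x (suc y) ≡ spread u x y ▵ spread u x (2 + y)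
  spread-vertical zero    zero          _ _ _  = refl
  spread-vertical zero    (suc (suc y)) _ _ _  = refl
  spread-vertical (suc x) zero x< y≤ p
    rewrite vertical x 0 x< y≤ (sym (trans p (not-involutive (par x)))) | bottom (suc x) =
    +ₜ-▵ 1 nothing (u (suc x) 2)
  spread-vertical (suc x) (suc y) x< y≤ p
    rewrite vertical x (suc y) x< y≤ (sym (trans p (not-involutive (par x)))) =
    +ₜ-▵ 1 (u (suc x) (suc y)) (u (suc x) (3 + y))

  corner-horizontal-up : ∀ i y → ∣ i ∣ < A → suc y ≤ A → par ∣ i ∣ ≡ par (suc y) →
    corner u i (+ suc y) ≡ corner u (ℤ.pred i) (+ suc y) ▵ corner u (ℤ.suc i) (+ suc y)
  corner-horizontal-up i y i< y≤ p = around (λ x → spread u x (suc y)) i (axis y p) off-axis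
    where
    axis : ∀ y → par ∣ i ∣ ≡ par (suc y) → ∣ i ∣ ≡ 0 → spread u 0 (suc y) ≡ nothing
    axis zero    p e with () ← trans (sym p) (cong par e)
    axis (suc _) p e = refl
    off-axis : ∀ n → ∣ i ∣ ≡ suc n → spread u (suc n) (suc y) ≡ spread u n (suc y) ▵ spread u (2 + n) (suc y)
    off-axis n e = spread-horizontal n (suc y) (subst (_< A) e i<) y≤ (trans (cong par (sym e)) p)

  corner-horizontal-axis : ∀ x → par (suc x) ≡ false →
    corner u (+ suc x) (+ 0) ≡ corner u (+ x) (+ 0) ▵ corner u (+ (2 + x)) (+ 0)
  corner-horizontal-axis (suc x) p = refl

  -- Turning by a right angle exchanges the two directions, so the rule used here is `vertical` of
  -- `u`. In column 0 the left parent lies in the empty third quadrant, which matches `bottom`.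
  corner-horizontal-down : ∀ x y → x < A → suc y < A → par x ≡ not (par y) →
    corner u (+ x) -[1+ y ] ≡ corner u (ℤ.pred (+ x)) -[1+ y ] ▵ corner u (+ suc x) -[1+ y ]
  corner-horizontal-down zero y x< y< p
    rewrite vertical y 0 y< x< (not-swap p) | bottom (suc y) = refl
  corner-horizontal-down (suc x) y x< y< p = vertical y (suc x) y< x< (not-swap p)

  corner-vertical-up : ∀ i y → ∣ i ∣ < A → suc y ≤ A → par ∣ i ∣ ≡ par y →
    corner u i (+ suc y) ≡ corner u i (+ y) ▵ corner u i (+ (2 + y))
  corner-vertical-up i y i< y≤ p = spread-vertical ∣ i ∣ y i< y≤ (cong not (sym p))

  -- The lower parent lies in the turned copy and the upper one in the upright copy; `mirror` makes
  -- them simultaneous, so both sides are `nothing`.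
  corner-vertical-axis : ∀ x → corner u (+ suc x) (+ 0) ≡ corner u (+ suc x) -[1+ 0 ] ▵ corner u (+ suc x) (+ 1)
  corner-vertical-axis x = sym (trans (cong (_▵ (1 +ₜ u (suc x) 1)) (mirror x)) (▵-diag (1 +ₜ u (suc x) 1)))

  corner-vertical-down : ∀ x y → x < A → suc y < A → par x ≡ par y →
    corner u (+ x) -[1+ y ] ≡ corner u (+ x) (ℤ.pred -[1+ y ]) ▵ corner u (+ x) (ℤ.suc -[1+ y ])
  -- The lower end of the central toothpick: the centre, at time 0, precedes the parent below, whose
  -- time `u 2 1` is not 0.
  corner-vertical-down zero zero x< y< p rewrite start with u 2 1 in e
  ... | just zero    = ⊥-elim (positive 2 1 e)
  ... | just (suc n) = refl
  ... | nothing      = refl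
  corner-vertical-down (suc x) zero x< y< p
    rewrite horizontal 0 (suc x) y< x< (sym p) (λ ()) | left (2 + x) = ▵-comm nothing (u 2 (2 + x))
  corner-vertical-down x (suc y) x< y< p =
    trans (horizontal (suc y) x y< x< (sym p) (λ ())) (▵-comm (u (suc y) (suc x)) (u (3 + y) (suc x)))

-- Blocks, and the rule across the seam of a grown block.

Filled : Bool → Maybe ℕ → Set
Filled true  p = ∃ λ n → p ≡ just n
Filled false p = p ≡ nothing

-- Everything that a corner structure attached at `(a , a)` has to know about the old block: `early`
-- puts all old times before its centre at `a + a - 1`, the edges alternate between filled and
-- empty, and `tip` is the parent of the centre.
record Block (a : ℕ) (u : Pattern) : Set where
  field
    lawful     : Lawful a u
    right-of   : ∀ {x} y → a ≤ x → u x y ≡ nothing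
    above      : ∀ x {y} → a < y → u x y ≡ nothing
    early      : ∀ x y {n} → u x y ≡ just n → suc n < a + a
    right-edge : ∀ y → suc y < a → Filled (par (suc y)) (u (pred a) (suc y))
    top-edge   : ∀ x → suc x < a → Filled (par (suc x)) (u (suc x) a)
    tip        : u (pred a) a ≡ just (pred (pred (a + a)))

glue-elim : {A : Set} {old new : A} (P : A → Set) → P old → P new → ∀ i j → P (glue old new i j)
glue-elim P o n _        (+ suc _) = n
glue-elim P o n (+ _)    (+ zero)  = n
glue-elim P o n -[1+ _ ] (+ zero)  = o
glue-elim P o n (+ _)    -[1+ _ ]  = n
glue-elim P o n -[1+ _ ] -[1+ _ ]  = o

-- A filled edge point obeyed the rule with an empty outer neighbour. A new neighbour later than the
-- inner parent leaves its time unchanged.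
absorb : ∀ {p q} r → r ≡ p ▵ nothing → Filled true r → (∀ n → p ≡ just n → q later-than n) → r ≡ p ▵ q
absorb {just n}          r refl _       late = sym (▵-later _ (late n refl))
absorb {nothing}         r refl (_ , ()) late

+ₜ-later : ∀ s p → (suc s +ₜ p) later-than s
+ₜ-later s (just m) _ refl = s≤s (m≤m+n s m)

m+1+n≡o⇒m<o : ∀ {m n o} → m + suc n ≡ o → m < o
m+1+n≡o⇒m<o {m} {n} refl = m<m+n m ℕ.z<s

-- An even side preserves the parity of both coordinates under the shift to `(a , a)`, so the
-- toothpicks keep their directions.
module Step (b : ℕ) (even : par b ≡ false) {u : Pattern} (B : Block (2 + b) u) where
  open Block B
  open Lawful lawful

  a s : ℕ
  a = 2 + b
  s = pred (a + a)

  even′ : par a ≡ false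
  even′ = trans (not-involutive (par b)) even

  -- The offsets from `(a , a)` are separate arguments, so that a proof can split on their signs
  -- while `x` and `y` still address the old block.
  cell : ℕ → ℕ → ℤ → ℤ → Maybe ℕ
  cell x y i j = glue (u x y) (s +ₜ corner u i j) i j

  par-⊝a : ∀ x {i} → x ⊝ a ≡ i → par ∣ i ∣ ≡ par x
  par-⊝a x refl = trans (par-⊝ x a) (trans (cong (par x xor_) even′) (xor-identityʳ (par x)))

  ∣i∣<a : ∀ x {i} → suc x < a + a → suc x ⊝ a ≡ i → ∣ i ∣ < a
  ∣i∣<a x {+ n} x< e = +-cancelˡ-< a n a (subst (_< a + a) (⊝≡+⇒ (suc x) a e) x<)
  ∣i∣<a x { -[1+ n ] } x< e = subst (suc n <_) (⊝≡-⇒ (suc x) a e) (s≤s (m≤n+m (suc n) x))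

  j≤a : ∀ {y j} → y ≤ a + a → y ⊝ a ≡ + j → j ≤ a
  j≤a {y} {j} y≤ e = +-cancelˡ-≤ a j a (subst (_≤ a + a) (⊝≡+⇒ y a e) y≤)

  1+j<a : ∀ y {j} → suc y ⊝ a ≡ -[1+ j ] → suc j < a
  1+j<a y {j} e = subst (suc j <_) (⊝≡-⇒ (suc y) a e) (s≤s (m≤n+m (suc j) y))

  on-axis : ∀ {x} → x ⊝ a ≡ + 0 → x ≡ a
  on-axis {x} e = trans (⊝≡+⇒ x a e) (+-identityʳ a)

  before : ∀ {x k} → x ⊝ a ≡ -[1+ k ] → x < a
  before {x} e = m+1+n≡o⇒m<o (⊝≡-⇒ x a e)

  just-before : ∀ {x} → x ⊝ a ≡ -[1+ 0 ] → x ≡ pred a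
  just-before {x} e = suc-injective (trans (sym (+-comm x 1)) (⊝≡-⇒ x a e))

  new-horizontal : ∀ i j → corner u i j ≡ corner u (ℤ.pred i) j ▵ corner u (ℤ.suc i) j →
    s +ₜ corner u i j ≡ s +ₜ corner u (ℤ.pred i) j ▵ s +ₜ corner u (ℤ.suc i) j
  new-horizontal i j e = trans (cong (s +ₜ_) e) (+ₜ-▵ s (corner u (ℤ.pred i) j) (corner u (ℤ.suc i) j))

  new-vertical : ∀ i j → corner u i j ≡ corner u i (ℤ.pred j) ▵ corner u i (ℤ.suc j) →
    s +ₜ corner u i j ≡ s +ₜ corner u i (ℤ.pred j) ▵ s +ₜ corner u i (ℤ.suc j)
  new-vertical i j e = trans (cong (s +ₜ_) e) (+ₜ-▵ s (corner u i (ℤ.pred j)) (corner u i (ℤ.suc j)))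

  new-late : ∀ {x y n} i j → u x y ≡ just n → (s +ₜ corner u i j) later-than n
  new-late {x} {y} i j e m e′ = ≤-<-trans (ℕ.s≤s⁻¹ (ℕ.s≤s⁻¹ (early x y e))) (+ₜ-later (pred s) (corner u i j) m e′)

  -- Away from the seam all three points are old or all three are new, and the rule of `u` or of the
  -- corner structure applies. Parents on opposite sides occur only at column `a` up to height `a`,
  -- and at column `a - 1` below height `a`.
  cell-horizontal : ∀ x y i j → suc x ⊝ a ≡ i → suc y ⊝ a ≡ j → suc x < a + a → suc y ≤ a + a →
    par ∣ i ∣ ≡ par ∣ j ∣ → par x ≡ par y → ¬ (x ≡ 0 × y ≡ 0) →
    cell (suc x) (suc y) i j ≡ cell x (suc y) (ℤ.pred i) j ▵ cell (2 + x) (suc y) (ℤ.suc i) j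
  cell-horizontal x y i (+ suc m) ex ey x< y≤ p q ≢0 =
    new-horizontal i (+ suc m) (corner-horizontal-up lawful i m (∣i∣<a x x< ex) (j≤a y≤ ey) p)
  cell-horizontal x y (+ suc n) (+ zero) ex ey x< y≤ p q ≢0 =
    new-horizontal (+ suc n) (+ 0) (corner-horizontal-axis lawful n p)
  -- The birth of the new centre: its left parent is the tip, at time `s - 1`, and its right
  -- neighbour is never reached.
  cell-horizontal x y (+ zero) (+ zero) ex ey x< y≤ p q ≢0 =
    trans (cong just (+-identityʳ s))
          (sym (cong (_▵ nothing) (trans (cong₂ u (suc-injective (on-axis ex)) (on-axis ey)) tip)))
  cell-horizontal x y -[1+ zero ] (+ zero) ex ey x< y≤ () q ≢0
  cell-horizontal x y -[1+ suc n ] (+ zero) ex ey x< y≤ p q ≢0 =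
    horizontal x y (before ex) (≤-reflexive (on-axis ey)) q ≢0
  cell-horizontal x y (+ suc n) -[1+ m ] ex ey x< y≤ p q ≢0 =
    new-horizontal (+ suc n) (-[1+ m ]) (corner-horizontal-down lawful (suc n) m (∣i∣<a x x< ex) (1+j<a y ey) p)
  -- The corner structure expects an empty third quadrant to the left; the old block has an even,
  -- hence empty, position of its right edge there.
  cell-horizontal x y (+ zero) -[1+ m ] ex ey x< y≤ p q ≢0 =
    trans (new-horizontal (+ 0) (-[1+ m ]) (corner-horizontal-down lawful 0 m (s≤s z≤n) (1+j<a y ey) p))
          (cong (_▵ (s +ₜ corner u (+ 1) -[1+ m ])) (sym empty))
    where
    empty : u x (suc y) ≡ nothing
    empty = subst₂ (λ c x′ → Filled c (u x′ (suc y))) (trans (sym (par-⊝a (suc y) ey)) (sym p))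
                   (sym (suc-injective (on-axis ex))) (right-edge y (before ey))
  -- An odd, hence filled, position of the right edge: its new right neighbour comes too late to
  -- matter.
  cell-horizontal x y -[1+ zero ] -[1+ m ] ex ey x< y≤ p q ≢0 =
    absorb _ (trans (horizontal x y (before ex) (<⇒≤ (before ey)) q ≢0)
                    (cong (u x (suc y) ▵_) (right-of (suc y) (≤-reflexive (sym (cong suc (just-before ex)))))))
             full (λ n e → new-late (+ 0) -[1+ m ] e)
    where
    full : Filled true (u (suc x) (suc y))
    full = subst₂ (λ c x′ → Filled c (u x′ (suc y))) (trans (sym (par-⊝a (suc y) ey)) (sym p))
                  (sym (just-before ex)) (right-edge y (before ey))
  cell-horizontal x y -[1+ suc n ] -[1+ m ] ex ey x< y≤ p q ≢0 =
    horizontal x y (before ex) (<⇒≤ (before ey)) q ≢0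

  -- The seam is now crossed upwards, to the left of column `a`, and the top edge takes over the
  -- part of the right edge.
  cell-vertical : ∀ x y i j → suc x ⊝ a ≡ i → suc y ⊝ a ≡ j → suc x < a + a → suc y ≤ a + a →
    par ∣ i ∣ ≡ not (par ∣ j ∣) → par x ≡ not (par y) →
    cell (suc x) (suc y) i j ≡ cell (suc x) y i (ℤ.pred j) ▵ cell (suc x) (2 + y) i (ℤ.suc j)
  cell-vertical x y i (+ suc (suc m)) ex ey x< y≤ p q =
    new-vertical i (+ suc (suc m))
      (corner-vertical-up lawful i (suc m) (∣i∣<a x x< ex) (j≤a y≤ ey) (trans p (not-involutive _)))
  cell-vertical x y (+ n) (+ suc zero) ex ey x< y≤ p q =
    new-vertical (+ n) (+ 1) (corner-vertical-up lawful (+ n) 0 (∣i∣<a x x< ex) (j≤a y≤ ey) (trans p (not-involutive _)))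
  -- The axis to the left of the new centre is replaced by the top row of the old block, which is
  -- empty at this parity.
  cell-vertical x y -[1+ n ] (+ suc zero) ex ey x< y≤ p q =
    trans (new-vertical (-[1+ n ]) (+ 1)
             (corner-vertical-up lawful -[1+ n ] 0 (∣i∣<a x x< ex) (j≤a y≤ ey) (trans p (not-involutive _))))
          (cong (_▵ (s +ₜ corner u -[1+ n ] (+ 2))) (sym empty))
    where
    empty : u (suc x) y ≡ nothing
    empty = subst₂ (λ c y′ → Filled c (u (suc x) y′)) (trans (sym (par-⊝a (suc x) ex)) p)
                   (sym (on-axis (trans (⊝-pred y a) (cong ℤ.pred ey)))) (top-edge x (before ex))
  cell-vertical x y (+ zero) (+ zero) ex ey x< y≤ () q
  cell-vertical x y (+ suc n) (+ zero) ex ey x< y≤ p q =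
    new-vertical (+ suc n) (+ 0) (corner-vertical-axis lawful n)
  -- A filled point of the top row, older than the new point above it.
  cell-vertical x y -[1+ n ] (+ zero) ex ey x< y≤ p q =
    absorb _ (trans (vertical x y (before ex) (≤-reflexive (on-axis ey)) q)
                    (cong (u (suc x) y ▵_) (above (suc x) (s≤s (≤-reflexive (sym (on-axis ey)))))))
             full (λ n e → new-late -[1+ _ ] (+ 1) e)
    where
    full : Filled true (u (suc x) (suc y))
    full = subst₂ (λ c y′ → Filled c (u (suc x) y′)) (trans (sym (par-⊝a (suc x) ex)) p)
                  (sym (on-axis ey)) (top-edge x (before ex))
  cell-vertical x y (+ n) -[1+ zero ] ex ey x< y≤ p q =
    new-vertical (+ n) (-[1+ 0 ]) (corner-vertical-down lawful n 0 (∣i∣<a x x< ex) (1+j<a y ey) (trans p (not-involutive _)))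
  cell-vertical x y (+ n) -[1+ suc m ] ex ey x< y≤ p q =
    new-vertical (+ n) (-[1+ suc m ])
      (corner-vertical-down lawful n (suc m) (∣i∣<a x x< ex) (1+j<a y ey) (trans p (not-involutive _)))
  cell-vertical x y -[1+ n ] -[1+ zero ] ex ey x< y≤ p q = vertical x y (before ex) (<⇒≤ (before ey)) q
  cell-vertical x y -[1+ n ] -[1+ suc m ] ex ey x< y≤ p q = vertical x y (before ex) (<⇒≤ (before ey)) q

  g : Pattern
  g = grow a u

  g-at : ∀ {x y i j} → x ⊝ a ≡ i → y ⊝ a ≡ j → g x y ≡ cell x y i j
  g-at refl refl = refl

  g-left : ∀ y → g 0 y ≡ nothing
  g-left y with y ⊝ a
  ... | + zero   = left y
  ... | + suc m  rewrite right-of (suc m) (≤-refl {a}) = refl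
  ... | -[1+ m ] = left y

  g-bottom : ∀ x → g x 0 ≡ nothing
  g-bottom x with x ⊝ a
  ... | + n rewrite right-of (suc n) (≤-refl {a}) = refl
  ... | -[1+ n ] = bottom x

  -- Beyond the old block, column 1 of `g` belongs to an upright copy and row 1 to the turned copy.
  -- Both show the last column of `u`, and the extra step of the upright copy is the delay that is
  -- asked for.
  g-mirror : ∀ y → g 1 (2 + y) ≡ 1 +ₜ g (1 + y) 1
  g-mirror y = trans (go ((2 + y) ⊝ a)) (cong (1 +ₜ_) (sym (g-at {1 + y} {1} (⊝-pred (1 + y) a) refl)))
    where
    go : ∀ j → cell 1 (2 + y) -[1+ b ] j ≡ 1 +ₜ cell (1 + y) 1 (ℤ.pred j) -[1+ b ]
    go (+ zero)  = mirror y
    go (+ suc m) with u (suc b) (suc m)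
    ... | just n  = cong just (+-suc s n)
    ... | nothing = refl
    go -[1+ m ]  = mirror y

  g-lawful : Lawful (a + a) g
  g-lawful = record
    { left       = g-left
    ; bottom     = g-bottom
    ; positive   = λ x y → glue-elim (_≢ just 0) (positive x y) (new-positive (corner u (x ⊝ a) (y ⊝ a))) (x ⊝ a) (y ⊝ a)
    ; start      = start
    ; mirror     = g-mirror
    ; horizontal = λ x y x< y≤ p ≢0 →
        trans (cell-horizontal x y _ _ refl refl x< y≤
                 (trans (par-⊝a (suc x) refl) (trans (cong not p) (sym (par-⊝a (suc y) refl)))) p ≢0)
              (cong₂ _▵_ (sym (g-at {x} {suc y} (⊝-pred x a) refl)) (sym (g-at {2 + x} {suc y} (⊝-suc (suc x) a) refl)))
    ; vertical   = λ x y x< y≤ p →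
        trans (cell-vertical x y _ _ refl refl x< y≤
                 (trans (par-⊝a (suc x) refl) (trans (cong not p) (cong not (sym (par-⊝a (suc y) refl))))) p)
              (cong₂ _▵_ (sym (g-at {suc x} {y} refl (⊝-pred y a))) (sym (g-at {suc x} {2 + y} refl (⊝-suc (suc y) a))))
    }
    where
    new-positive : ∀ p → s +ₜ p ≢ just 0
    new-positive (just n) ()
    new-positive nothing  ()

  g-block : Block (a + a) g
  g-block = record
    { lawful     = g-lawful
    ; right-of   = g-right-of
    ; above      = g-above
    ; early      = g-early
    ; right-edge = λ y y< → subst (Filled (par (suc y))) (sym (g-at {s} {suc y} s⊝a refl)) (g-right-edge y _ refl y<)
    ; top-edge   = λ x x< → subst (Filled (par (suc x))) (sym (g-at {suc x} {a + a} refl a+a⊝a)) (g-top-edge x _ refl x<)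
    -- The new tip is the tip of the upright first-quadrant copy, at time `s + 1 + (2a - 2)`, which
    -- is `4a - 2`.
    ; tip        = trans (g-at {s} {a + a} s⊝a a+a⊝a)
                     (trans (cong (λ p → s +ₜ 1 +ₜ p) tip) (cong just (sym (+-suc (b + a) s))))
    }
    where
    +⊝ : ∀ m n → (m + n) ⊝ n ≡ + m
    +⊝ m n = trans (ℤₚ.⊖-≥ (m≤n+m n m)) (cong +_ (m+n∸n≡m m n))

    s⊝a : s ⊝ a ≡ + suc b
    s⊝a = +⊝ (suc b) a

    a+a⊝a : (a + a) ⊝ a ≡ + a
    a+a⊝a = +⊝ a a

    Filled-+ₜ : ∀ c t p → Filled c p → Filled c (t +ₜ p)
    Filled-+ₜ true  t p (n , refl) = t + n , refl
    Filled-+ₜ false t p refl       = refl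

    far : ∀ {x i} → a + a ≤ x → x ⊝ a ≡ i → ∃ λ n → i ≡ + n × a + n ≡ x
    far {x} {+ n}      A≤x e = n , refl , sym (⊝≡+⇒ x a e)
    far {x} { -[1+ n ] } A≤x e = ⊥-elim (<-irrefl refl (<-≤-trans (before e) (≤-trans (m≤m+n a a) A≤x)))

    g-right-of : ∀ {x} y → a + a ≤ x → g x y ≡ nothing
    g-right-of {x} y A≤x with n , e , refl ← far A≤x refl =
      trans (g-at {a + n} {y} e refl) (empty n (+-cancelˡ-≤ a a n A≤x) (y ⊝ a))
      where
      empty : ∀ n → a ≤ n → ∀ j → cell x y (+ n) j ≡ nothing
      empty (suc n) a≤n (+ zero)  = refl
      empty (suc n) a≤n (+ suc m) = cong (λ p → s +ₜ 1 +ₜ p) (right-of (suc m) a≤n)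
      empty n       a≤n -[1+ m ]  = cong (s +ₜ_) (above (suc m) (s≤s a≤n))

    g-above : ∀ x {y} → a + a < y → g x y ≡ nothing
    g-above x {y} A<y with m , e , refl ← far (<⇒≤ A<y) refl =
      trans (g-at {x} {a + m} refl e) (empty m (+-cancelˡ-< a a m A<y) (x ⊝ a))
      where
      spread-empty : ∀ m → a < m → ∀ n → spread u n m ≡ nothing
      spread-empty (suc (suc m)) a<m zero    = refl
      spread-empty (suc m)       a<m (suc n) = cong (1 +ₜ_) (above (suc n) a<m)
      spread-empty (suc zero) (s≤s ()) zero
      empty : ∀ m → a < m → ∀ i → cell x y i (+ m) ≡ nothing
      empty (suc m) a<m i = cong (s +ₜ_) (spread-empty (suc m) a<m ∣ i ∣)

    corner-early : ∀ i j {n} → corner u i j ≡ just n → n ≤ s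
    corner-early i (+ m) = spread-early ∣ i ∣ m
      where
      spread-early : ∀ x y {n} → spread u x y ≡ just n → n ≤ s
      spread-early zero    zero       refl = z≤n
      spread-early zero    (suc zero) refl = s≤s z≤n
      spread-early (suc x) (suc y)    e with u (suc x) (suc y) in e′
      spread-early (suc x) (suc y) refl | just n = ℕ.s≤s⁻¹ (early (suc x) (suc y) e′)
    corner-early (+ n) -[1+ m ] e = ≤-trans (n≤1+n _) (ℕ.s≤s⁻¹ (early (suc m) (suc n) e))

    Early : Maybe ℕ → Set
    Early p = ∀ {n} → p ≡ just n → suc n < (a + a) + (a + a)

    g-early : ∀ x y → Early (g x y)
    g-early x y = glue-elim Early old new (x ⊝ a) (y ⊝ a)
      where
      old : Early (u x y)
      old e = <-≤-trans (early x y e) (m≤m+n (a + a) (a + a))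
      new : Early (s +ₜ corner u (x ⊝ a) (y ⊝ a))
      new e with corner u (x ⊝ a) (y ⊝ a) in e′
      new refl | just n = s≤s (+-monoʳ-< s (s≤s (corner-early (x ⊝ a) (y ⊝ a) e′)))

    -- Above height `a` the edge is the right edge of an upright copy; below it is the top row of
    -- `u`, turned into a column.
    g-right-edge : ∀ y j → suc y ⊝ a ≡ j → suc y < a + a → Filled (par (suc y)) (cell s (suc y) (+ suc b) j)
    g-right-edge y (+ zero) e y< rewrite sym (par-⊝a (suc y) e) = refl
    g-right-edge y (+ suc m) e y< rewrite sym (par-⊝a (suc y) e) =
      Filled-+ₜ (par (suc m)) s _ (Filled-+ₜ (par (suc m)) 1 _ (right-edge m (∣i∣<a y y< e)))
    g-right-edge y -[1+ m ] e y< rewrite sym (par-⊝a (suc y) e) =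
      Filled-+ₜ (par (suc m)) s _ (top-edge m (∣i∣<a y y< e))

    g-top-edge : ∀ x i → suc x ⊝ a ≡ i → suc x < a + a → Filled (par (suc x)) (cell (suc x) (a + a) i (+ a))
    g-top-edge x (+ zero) e x< rewrite sym (par-⊝a (suc x) e) = refl
    g-top-edge x (+ suc n) e x< rewrite sym (par-⊝a (suc x) e) =
      Filled-+ₜ (par (suc n)) s _ (Filled-+ₜ (par (suc n)) 1 _ (top-edge n (∣i∣<a x x< e)))
    g-top-edge x -[1+ n ] e x< rewrite sym (par-⊝a (suc x) e) =
      Filled-+ₜ (par (suc n)) s _ (Filled-+ₜ (par (suc n)) 1 _ (top-edge n (∣i∣<a x x< e)))

-- Support of the blocks and their limit.

module _ {a : ℕ} where

  inside⇒ : ∀ {A : Set} {old new : A} {x y} → x < a → y ≤ a → glue old new (x ⊝ a) (y ⊝ a) ≡ old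
  inside⇒ {x = x} {y} x<a y≤a with x ⊝ a in ex | y ⊝ a in ey
  ... | + n      | _       = ⊥-elim (m+n≮m a n (subst (_< a) (⊝≡+⇒ x a ex) x<a))
  ... | -[1+ _ ] | + suc m = ⊥-elim (m+1+n≰m a (subst (_≤ a) (⊝≡+⇒ y a ey) y≤a))
  ... | -[1+ _ ] | + zero  = refl
  ... | -[1+ _ ] | -[1+ m ] = refl

corner⇒outside : ∀ u i j {n} → corner u i j ≡ just n → ∀ {A : Set} {old new : A} → glue old new i j ≡ new
corner⇒outside u i     (+ suc _) _ = refl
corner⇒outside u (+ _) (+ zero)  _ = refl
corner⇒outside u (+ _) -[1+ _ ]  _ = refl

Supported : ℕ → Pattern → Set
Supported a u = ∀ x y {n} → u x y ≡ just n → (0 < x × x < a) × (0 < y × y ≤ a)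

par-double : ∀ m → par (m + m) ≡ false
par-double zero    = refl
par-double (suc m) = trans (cong (λ n → not (par n)) (+-suc m m)) (trans (not-involutive _) (par-double m))

even-size : ∀ k → ∃ λ b → 2 ^ suc k ≡ 2 + b × par b ≡ false
even-size k with 2 ^ k | m^n>0 2 k
... | suc m | _ = m + m , cong suc (trans (cong (m ℕ.+_) (cong suc (+-identityʳ m))) (+-suc m m)) , par-double m

grow-block : ∀ {a u} → (∃ λ b → a ≡ 2 + b × par b ≡ false) → Block a u → Block (a + a) (grow a u)
grow-block (b , refl , even) B = Step.g-block b even B

-- The block of side 1 is empty and has no tip, so the induction starts at side 2, with (1 , 1) at
-- time 1 and (1 , 2) at time 2.
quad₁-block : Block 2 (quad 1)
quad₁-block = record
  { lawful = record
    { left       = λ { zero → refl ; (suc zero) → refl ; (suc (suc y)) → refl }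
    ; bottom     = λ { zero → refl ; (suc x) → refl }
    ; positive   = λ { zero zero () ; zero (suc zero) () ; zero (suc (suc y)) () ; (suc x) zero ()
                     ; (suc zero) (suc zero) () ; (suc zero) (suc (suc zero)) () ; (suc zero) (suc (suc (suc y))) ()
                     ; (suc (suc x)) (suc zero) () ; (suc (suc x)) (suc (suc y)) () }
    ; start      = refl
    ; mirror     = λ { zero → refl ; (suc y) → refl }
    ; horizontal = λ { zero zero _ _ _ ≢0 → ⊥-elim (≢0 (refl , refl)) ; zero (suc zero) _ _ () _
                     ; zero (suc (suc _)) _ (s≤s (s≤s ())) _ _ ; (suc x) _ (s≤s (s≤s ())) _ _ _ }
    ; vertical   = λ { zero zero _ _ () ; zero (suc zero) _ _ _ → refl
                     ; zero (suc (suc _)) _ (s≤s (s≤s ())) _ ; (suc x) _ (s≤s (s≤s ())) _ _ }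
    }
  ; right-of   = λ { zero (s≤s (s≤s _)) → refl ; (suc zero) (s≤s (s≤s _)) → refl ; (suc (suc _)) (s≤s (s≤s _)) → refl }
  ; above      = λ { zero (s≤s (s≤s (s≤s _))) → refl ; (suc zero) (s≤s (s≤s (s≤s _))) → refl ; (suc (suc x)) (s≤s (s≤s (s≤s _))) → refl }
  ; early      = λ { (suc zero) (suc zero) refl → s≤s (s≤s (s≤s z≤n)) ; (suc zero) (suc (suc zero)) refl → s≤s (s≤s (s≤s (s≤s z≤n)))
                   ; zero zero () ; zero (suc zero) () ; zero (suc (suc y)) () ; (suc x) zero ()
                   ; (suc zero) (suc (suc (suc y))) () ; (suc (suc x)) (suc zero) () ; (suc (suc x)) (suc (suc y)) () }
  ; right-edge = λ { zero _ → 1 , refl ; (suc y) (s≤s (s≤s ())) }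
  ; top-edge   = λ { zero _ → 2 , refl ; (suc x) (s≤s (s≤s ())) }
  ; tip        = refl
  }

quad-block : ∀ k → Block (2 ^ suc k) (quad (suc k))
quad-block zero    = quad₁-block
quad-block (suc k) =
  subst (λ a → Block a (quad (2 + k))) (cong (2 ^ suc k ℕ.+_) (sym (+-identityʳ (2 ^ suc k))))
        (grow-block (even-size k) (quad-block k))

quad-supported : ∀ k → Supported (2 ^ k) (quad k)
quad-supported (suc k) x y {n} e = (pos x (λ { refl → left y }) , <-of x y e) , (pos y (λ { refl → bottom x }) , ≤-of x y e)
  where
  open Block (quad-block k)
  open Lawful lawful
  pos : ∀ z → (z ≡ 0 → quad (suc k) x y ≡ nothing) → 0 < z
  pos zero    h with () ← trans (sym e) (h refl)
  pos (suc z) h = s≤s z≤n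
  just≢nothing : just n ≢ nothing
  just≢nothing ()
  <-of : ∀ x y → quad (suc k) x y ≡ just n → x < 2 ^ suc k
  <-of x y e = ≰⇒> λ a≤x → just≢nothing (trans (sym e) (right-of y a≤x))
  ≤-of : ∀ x y → quad (suc k) x y ≡ just n → y ≤ 2 ^ suc k
  ≤-of x y e = ≮⇒≥ λ a<y → just≢nothing (trans (sym e) (above x a<y))

-- The index `x + y` is large enough: `n < 2 ^ n` puts the point inside that block, and growth never
-- alters a block.
quadrant : Pattern
quadrant x y = quad (x + y) x y

n<2^n : ∀ n → n < 2 ^ n
n<2^n zero    = s≤s z≤n
n<2^n (suc n) = +-mono-≤ (m^n>0 2 n) (≤-trans (n<2^n n) (m≤m+n (2 ^ n) 0))

quadrant≡quad+ : ∀ x y d → quadrant x y ≡ quad (d + (x + y)) x y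
quadrant≡quad+ x y zero    = refl
quadrant≡quad+ x y (suc d) = trans (quadrant≡quad+ x y d) (sym (inside⇒ x< y≤))
  where
  x+y< : x + y < 2 ^ (d + (x + y))
  x+y< = <-≤-trans (n<2^n (x + y)) (^-monoʳ-≤ 2 (m≤n+m (x + y) d))
  x< : x < 2 ^ (d + (x + y))
  x< = ≤-<-trans (m≤m+n x y) x+y<
  y≤ : y ≤ 2 ^ (d + (x + y))
  y≤ = ≤-trans (m≤n+m y x) (<⇒≤ x+y<)

quadrant≡quad : ∀ x y {k} → x + y ≤ k → quadrant x y ≡ quad k x y
quadrant≡quad x y {k} x+y≤k =
  trans (quadrant≡quad+ x y (k ∸ (x + y))) (cong (λ j → quad j x y) (m∸n+n≡m x+y≤k))

-- Each law compares a few neighbouring values, all of which can be read in one common block that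
-- has the point in its interior. The limit has no edge, so every bound is allowed.
quadrant-lawful : ∀ A → Lawful A quadrant
quadrant-lawful A = record
  { left       = λ { zero → refl ; (suc y) → Lawful.left (laws y) (suc y) }
  ; bottom     = λ { zero → refl ; (suc x) → Lawful.bottom (laws (x + 0)) (suc x) }
  ; positive   = λ { zero zero () ; zero (suc y) → Lawful.positive (laws y) 0 (suc y)
                   ; (suc x) y → Lawful.positive (laws (x + y)) (suc x) y }
  ; start      = refl
  ; mirror     = λ y → trans (Lawful.mirror (laws (2 + y)) y)
                   (cong (1 +ₜ_) (sym (quadrant≡quad (1 + y) 1 (s≤s (≤-trans (≤-reflexive (+-comm y 1)) (n≤1+n _))))))
  ; horizontal = λ x y _ _ p ≢0 →
      trans (quadrant≡quad (suc x) (suc y) (n≤1+n _))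
        (trans (Lawful.horizontal (laws (suc (x + suc y))) x y (x< x y) (y≤ x y) p ≢0)
          (cong₂ _▵_ (sym (quadrant≡quad x (suc y) (≤-trans (n≤1+n _) (n≤1+n _)))) (sym (quadrant≡quad (2 + x) (suc y) ≤-refl))))
  ; vertical   = λ x y _ _ p →
      trans (quadrant≡quad (suc x) (suc y) (n≤1+n _))
        (trans (Lawful.vertical (laws (suc (x + suc y))) x y (x< x y) (y≤ x y) p)
          (cong₂ _▵_ (sym (quadrant≡quad (suc x) y (s≤s (≤-trans (+-monoʳ-≤ x (n≤1+n y)) (n≤1+n _)))))
                     (sym (quadrant≡quad (suc x) (2 + y) (s≤s (≤-reflexive (+-suc x (suc y))))))))
  }
  where
  laws : ∀ k → Lawful (2 ^ suc k) (quad (suc k))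
  laws k = Block.lawful (quad-block k)
  big : ∀ x y → 2 + (x + suc y) < 2 ^ (2 + (x + suc y))
  big x y = n<2^n (2 + (x + suc y))
  x< : ∀ x y → suc x < 2 ^ (2 + (x + suc y))
  x< x y = ≤-<-trans (s≤s (≤-trans (m≤m+n x (suc y)) (n≤1+n _))) (big x y)
  y≤ : ∀ x y → suc y ≤ 2 ^ (2 + (x + suc y))
  y≤ x y = ≤-trans (m≤n+m (suc y) (2 + x)) (<⇒≤ (big x y))

-- The centre of the added corner structure arrives at `2 ^ suc k - 1`, so nothing earlier is new.
quad-suc-early : ∀ k x y {n} → suc n < 2 ^ suc k → quad (suc k) x y ≡ just n → quad k x y ≡ just n
quad-suc-early k x y {n} n< =
  glue-elim (λ p → p ≡ just n → quad k x y ≡ just n) (λ e → e) (new (corner (quad k) (x ⊝ 2 ^ k) (y ⊝ 2 ^ k)))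
            (x ⊝ 2 ^ k) (y ⊝ 2 ^ k)
  where
  a+a : 2 ^ k + 2 ^ k ≡ 2 ^ suc k
  a+a = cong (2 ^ k ℕ.+_) (sym (+-identityʳ (2 ^ k)))
  new : ∀ p → pred (2 ^ k + 2 ^ k) +ₜ p ≡ just n → quad k x y ≡ just n
  new (just m) refl = ⊥-elim (<-irrefl refl (<-≤-trans n<
    (≤-trans (≤-reflexive (sym a+a)) (≤-trans (suc-pred-≤ (2 ^ k + 2 ^ k)) (s≤s (m≤m+n _ m))))))
    where
    suc-pred-≤ : ∀ n → n ≤ suc (pred n)
    suc-pred-≤ zero    = z≤n
    suc-pred-≤ (suc n) = ≤-refl

quad-mono : ∀ k x y {n} → quad k x y ≡ just n → quad (suc k) x y ≡ just n
quad-mono k x y e with (_ , x<) , (_ , y≤) ← quad-supported k x y e = trans (inside⇒ x< y≤) e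

quadrant⇒quad : ∀ k x y {n} → suc n < 2 ^ suc k → quadrant x y ≡ just n → quad k x y ≡ just n
quadrant⇒quad k x y {n} n< e = go (x + y) (trans (sym (quadrant≡quad x y (m≤m+n (x + y) k))) e)
  where
  go : ∀ d → quad (d + k) x y ≡ just n → quad k x y ≡ just n
  go zero    e = e
  go (suc d) e = go d (quad-suc-early (d + k) x y (<-≤-trans n< (^-monoʳ-≤ 2 (s≤s (m≤n+m k d)))) e)

quad⇒quadrant : ∀ k x y {n} → quad k x y ≡ just n → quadrant x y ≡ just n
quad⇒quadrant k x y {n} e = trans (quadrant≡quad x y (m≤m+n (x + y) k)) (go (x + y))
  where
  go : ∀ d → quad (d + k) x y ≡ just n
  go zero    = e
  go (suc d) = quad-mono (d + k) x y (go d)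

-- Counting the points that arrive at a given time.

unique-⊆⇒length≤ : {xs ys : List A} → Unique xs → (∀ {z} → z ∈ xs → z ∈ ys) → length xs ≤ length ys
unique-⊆⇒length≤ {xs = []}     _          _     = z≤n
unique-⊆⇒length≤ {xs = x ∷ xs} (x∉ ∷ uxs) xs⊆ys with ys₁ , ys₂ , refl ← ∈-∃++ (xs⊆ys (here refl)) =
  ≤-trans (s≤s (unique-⊆⇒length≤ uxs smaller))
    (≤-reflexive (trans (cong suc (length-++ ys₁)) (trans (sym (+-suc (length ys₁) (length ys₂))) (sym (length-++ ys₁)))))
  where
  smaller : ∀ {z} → z ∈ xs → z ∈ ys₁ ++ ys₂
  smaller z∈xs with ∈-++⁻ ys₁ (xs⊆ys (there z∈xs))
  ... | inj₁ z∈ys₁         = ∈-++⁺ˡ z∈ys₁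
  ... | inj₂ (here refl)   = ⊥-elim (All.lookup x∉ z∈xs refl)
  ... | inj₂ (there z∈ys₂) = ∈-++⁺ʳ ys₁ z∈ys₂

unique-map : (f : A → B) (h : B → A) {xs : List A} → (∀ {x} → x ∈ xs → h (f x) ≡ x) → Unique xs → Unique (map f xs)
unique-map f h {[]}     inv []         = []
unique-map f h {x ∷ xs} inv (x∉ ∷ uxs) = All.tabulate distinct ∷ unique-map f h (inv ∘ there) uxs
  where
  distinct : ∀ {y} → y ∈ map f xs → f x ≢ y
  distinct y∈ e with x′ , x′∈ , refl ← ∈-map⁻ f y∈ =
    All.lookup x∉ x′∈ (trans (sym (inv (here refl))) (trans (cong h e) (inv (there x′∈))))

record LevelSet (p : A → Maybe ℕ) (n : ℕ) (size : ℕ) : Set where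
  field
    members  : List A
    unique   : Unique members
    sound    : ∀ {x} → x ∈ members → p x ≡ just n
    complete : ∀ {x} → p x ≡ just n → x ∈ members
    counted  : length members ≡ size

Counts : (A → Maybe ℕ) → (ℕ → ℕ) → Set
Counts p f = ∀ n → LevelSet p n (f n)

-- Multiplication by x^s on coefficient sequences.
delay : ℕ → (ℕ → ℕ) → ℕ → ℕ
delay zero    f n       = f n
delay (suc s) f zero    = 0
delay (suc s) f (suc n) = delay s f n

δ : ℕ → ℕ
δ zero    = 1
δ (suc _) = 0

emptyLevel : {p : A → Maybe ℕ} {n : ℕ} → (∀ x → p x ≢ just n) → LevelSet p n 0
emptyLevel none = record
  { members = [] ; unique = [] ; sound = λ () ; complete = λ {x} e → ⊥-elim (none x e) ; counted = refl }

counts-none : Counts {A} (λ _ → nothing) (λ _ → 0)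
counts-none n = emptyLevel λ _ ()

counts-point : Counts {⊤} (λ _ → just 0) δ
counts-point zero = record
  { members = [ tt ] ; unique = [] ∷ [] ; sound = λ _ → refl ; complete = λ _ → here refl ; counted = refl }
counts-point (suc n) = emptyLevel λ _ ()

-- The inverse laws are asked only of points that arrive, so the maps may collapse the unreached
-- points of overlapping coordinate ranges.
counts-transport : {p : A → Maybe ℕ} {q : B → Maybe ℕ} (g : A → B) (h : B → A) →
  (∀ x {n} → p x ≡ just n → q (g x) ≡ just n × h (g x) ≡ x) →
  (∀ y {n} → q y ≡ just n → p (h y) ≡ just n × g (h y) ≡ y) →
  ∀ {f} → Counts p f → Counts q f
counts-transport {p = p} {q} g h to from c n = record
  { members  = map g members
  ; unique   = unique-map g h (λ x∈ → proj₂ (to _ (sound x∈))) unique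
  ; sound    = λ y∈ → let x , x∈ , e = ∈-map⁻ g y∈ in trans (cong q e) (proj₁ (to x (sound x∈)))
  ; complete = λ {y} e → subst (_∈ map g members) (proj₂ (from y e)) (∈-map⁺ g (complete (proj₁ (from y e))))
  ; counted  = trans (length-map g members) counted
  }
  where open LevelSet (c n)

counts-⊎ : {p : A → Maybe ℕ} {q : B → Maybe ℕ} {f g : ℕ → ℕ} →
  Counts p f → Counts q g → Counts [ p , q ]′ (λ n → f n + g n)
counts-⊎ {p = p} {q} c d n = record
  { members  = map inj₁ P.members ++ map inj₂ Q.members
  ; unique   = Uniqueₚ.++⁺ (Uniqueₚ.map⁺ inj₁-injective P.unique) (Uniqueₚ.map⁺ inj₂-injective Q.unique) disjoint
  ; sound    = λ x∈ → [ (λ x∈ → let y , y∈ , e = ∈-map⁻ inj₁ x∈ in trans (cong [ p , q ]′ e) (P.sound y∈))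
                      , (λ x∈ → let y , y∈ , e = ∈-map⁻ inj₂ x∈ in trans (cong [ p , q ]′ e) (Q.sound y∈))
                      ]′ (∈-++⁻ (map inj₁ P.members) x∈)
  ; complete = λ { {inj₁ x} e → ∈-++⁺ˡ (∈-map⁺ inj₁ (P.complete e))
                 ; {inj₂ y} e → ∈-++⁺ʳ (map inj₁ P.members) (∈-map⁺ inj₂ (Q.complete e)) }
  ; counted  = trans (length-++ (map inj₁ P.members))
                 (cong₂ _+_ (trans (length-map inj₁ P.members) P.counted) (trans (length-map inj₂ Q.members) Q.counted))
  }
  where
  module P = LevelSet (c n)
  module Q = LevelSet (d n)
  disjoint : ∀ {x} → x ∈ map inj₁ P.members × x ∈ map inj₂ Q.members → ⊥
  disjoint (x∈ , x∈′) with _ , _ , refl ← ∈-map⁻ inj₁ x∈ with _ , _ , () ← ∈-map⁻ inj₂ x∈′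

counts-+ₜ : ∀ s {p : A → Maybe ℕ} {f} → Counts p f → Counts (λ x → s +ₜ p x) (delay s f)
counts-+ₜ {A} s {p} {f} c n = go s n
  where
  relevel : ∀ {q r : A → Maybe ℕ} {m n size} → (∀ x → q x ≡ just m → r x ≡ just n) →
            (∀ x → r x ≡ just n → q x ≡ just m) → LevelSet q m size → LevelSet r n size
  relevel to from L = record
    { members = members ; unique = unique ; sound = λ x∈ → to _ (sound x∈)
    ; complete = λ e → complete (from _ e) ; counted = counted }
    where open LevelSet L
  go : ∀ s n → LevelSet (λ x → s +ₜ p x) n (delay s f n)
  go zero    n       = relevel (λ x e → trans (map-id (p x)) e) (λ x e → trans (sym (map-id (p x))) e) (c n)
  go (suc s) zero    = emptyLevel none
    where
    none : ∀ x → suc s +ₜ p x ≢ just 0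
    none x e with p x
    none x () | just _
    none x () | nothing
  go (suc s) (suc n) = relevel to from (go s n)
    where
    to : ∀ x → s +ₜ p x ≡ just n → suc s +ₜ p x ≡ just (suc n)
    to x e with p x
    to x refl | just _ = refl
    from : ∀ x → suc s +ₜ p x ≡ just (suc n) → s +ₜ p x ≡ just n
    from x e with p x
    from x refl | just _ = refl

counts-unique : {p : A → Maybe ℕ} {n k l : ℕ} → LevelSet p n k → LevelSet p n l → k ≡ l
counts-unique K L = ≤-antisym (le K L) (le L K)
  where
  le : ∀ {p n k l} → LevelSet p n k → LevelSet p n l → k ≤ l
  le K L = subst₂ _≤_ K.counted L.counted (unique-⊆⇒length≤ K.unique (L.complete ∘ K.sound))
    where
    module K = LevelSet K
    module L = LevelSet L

-- The summands are the centre, its upper end, the two upright copies one step late, and the turned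
-- copy without delay.
cornerSize : (ℕ → ℕ) → ℕ → ℕ
cornerSize f n = δ n + (delay 1 δ n + (delay 1 f n + (delay 1 f n + f n)))

quadSize : ℕ → ℕ → ℕ
quadSize zero    n = 0
quadSize (suc k) n = quadSize k n + delay (pred (2 ^ k + 2 ^ k)) (cornerSize (quadSize k)) n

counts-corner : ∀ {u : Pattern} {f} → (∀ x y {n} → u x y ≡ just n → 0 < x × 0 < y) →
  Counts (λ (x , y) → u x y) f →
  Counts (λ (i , j) → corner u i j) (cornerSize f)
counts-corner {u = u} supp c =
  counts-transport to from to-ok from-ok
    (counts-⊎ counts-point (counts-⊎ (counts-+ₜ 1 counts-point)
      (counts-⊎ (counts-+ₜ 1 c) (counts-⊎ (counts-+ₜ 1 c) c))))
  where
  Piece : Set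
  Piece = ⊤ ⊎ (⊤ ⊎ ((ℕ × ℕ) ⊎ ((ℕ × ℕ) ⊎ (ℕ × ℕ))))
  to : Piece → ℤ × ℤ
  to (inj₁ tt)                             = + 0 , + 0
  to (inj₂ (inj₁ tt))                      = + 0 , + 1
  to (inj₂ (inj₂ (inj₁ (x , y))))          = + x , + y
  to (inj₂ (inj₂ (inj₂ (inj₁ (x , y)))))   = ℤ.- (+ x) , + y
  to (inj₂ (inj₂ (inj₂ (inj₂ (x , y)))))   = + pred y , ℤ.- (+ x)
  from : ℤ × ℤ → Piece
  from (+ x , -[1+ y ])      = inj₂ (inj₂ (inj₂ (inj₂ (suc y , suc x))))
  from (+ zero , + zero)     = inj₁ tt
  from (+ zero , + suc y)    = inj₂ (inj₁ tt)
  from (+ suc x , + y)       = inj₂ (inj₂ (inj₁ (suc x , y)))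
  from (-[1+ x ] , + y)      = inj₂ (inj₂ (inj₂ (inj₁ (suc x , y))))
  from (-[1+ _ ] , -[1+ _ ]) = inj₁ tt
  time : Piece → Maybe ℕ
  time = [ (λ _ → just 0) , [ (λ _ → just 1) , [ (λ (x , y) → 1 +ₜ u x y) , [ (λ (x , y) → 1 +ₜ u x y) , (λ (x , y) → u x y) ]′ ]′ ]′ ]′
  supp₁ : ∀ x y {n} → 1 +ₜ u x y ≡ just n → 0 < x × 0 < y
  supp₁ x y e with u x y in e′
  ... | just m = supp x y e′
  to-ok : ∀ z {n} → time z ≡ just n → corner u (proj₁ (to z)) (proj₂ (to z)) ≡ just n × from (to z) ≡ z
  to-ok (inj₁ tt) e = e , refl
  to-ok (inj₂ (inj₁ tt)) e = e , refl
  to-ok (inj₂ (inj₂ (inj₁ (x , y)))) e with supp₁ x y e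
  to-ok (inj₂ (inj₂ (inj₁ (suc x , suc y)))) e | _ = e , refl
  to-ok (inj₂ (inj₂ (inj₁ (suc x , zero)))) e | _ , ()
  to-ok (inj₂ (inj₂ (inj₂ (inj₁ (x , y))))) e with supp₁ x y e
  to-ok (inj₂ (inj₂ (inj₂ (inj₁ (suc x , suc y))))) e | _ = e , refl
  to-ok (inj₂ (inj₂ (inj₂ (inj₁ (suc x , zero))))) e | _ , ()
  to-ok (inj₂ (inj₂ (inj₂ (inj₂ (x , y))))) e with supp x y e
  to-ok (inj₂ (inj₂ (inj₂ (inj₂ (suc x , suc y))))) e | _ = e , refl
  to-ok (inj₂ (inj₂ (inj₂ (inj₂ (suc x , zero))))) e | _ , ()
  from-ok : ∀ q {n} → corner u (proj₁ q) (proj₂ q) ≡ just n → time (from q) ≡ just n × to (from q) ≡ q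
  from-ok (+ zero , + zero) e = e , refl
  from-ok (+ zero , + suc zero) e = e , refl
  from-ok (+ suc x , + suc y) e = e , refl
  from-ok (-[1+ x ] , + suc y) e = e , refl
  from-ok (+ x , -[1+ y ]) e = e , refl

counts-grow : ∀ {a u f} → Supported a u → Counts (λ (x , y) → u x y) f →
  Counts (λ (x , y) → grow a u x y) (λ n → f n + delay (pred (a + a)) (cornerSize f) n)
counts-grow {a} {u} supp c =
  counts-transport to from to-ok from-ok (counts-⊎ c (counts-+ₜ (pred (a + a)) (counts-corner (λ x y e → let (x> , _) , (y> , _) = supp x y e in x> , y>) c)))
  where
  s : ℕ
  s = pred (a + a)
  to : (ℕ × ℕ) ⊎ (ℤ × ℤ) → ℕ × ℕ
  to (inj₁ q)       = q
  -- The absolute values lose nothing on reached points: their offsets exceed `- a`, as `restore`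
  -- shows from the support of `u`.
  to (inj₂ (i , j)) = ∣ i ℤ.+ + a ∣ , ∣ j ℤ.+ + a ∣
  from : ℕ × ℕ → (ℕ × ℕ) ⊎ (ℤ × ℤ)
  from (x , y) = glue (inj₁ (x , y)) (inj₂ (x ⊝ a , y ⊝ a)) (x ⊝ a) (y ⊝ a)
  time : (ℕ × ℕ) ⊎ (ℤ × ℤ) → Maybe ℕ
  time = [ (λ (x , y) → u x y) , (λ (i , j) → s +ₜ corner u i j) ]′
  +⊝ : ∀ n → (n + a) ⊝ a ≡ + n
  +⊝ n = trans (ℤₚ.⊖-≥ (m≤n+m a n)) (cong +_ (m+n∸n≡m n a))
  ∣⊝+∣ : ∀ n → ∣ (n ⊝ a) ℤ.+ + a ∣ ≡ n
  ∣⊝+∣ n = cong ∣_∣ (trans (ℤₚ.distribˡ-⊖-+-pos a n a) (+⊝ n))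
  ∣-+∣⊝ : ∀ {k} → suc k ≤ a → ∣ -[1+ k ] ℤ.+ + a ∣ ⊝ a ≡ -[1+ k ]
  ∣-+∣⊝ {k} k<a = trans (cong₂ _⊝_ (cong ∣_∣ (ℤₚ.⊖-≥ k<a)) (sym (m∸n+n≡m k<a)))
    (trans (cong (_⊝ (d + suc k)) (sym (+-identityʳ d))) (ℤₚ.+-cancelˡ-⊖ d 0 (suc k)))
    where d = a ∸ suc k
  spread-restore : ∀ i y {n} → spread u ∣ i ∣ y ≡ just n → ∣ i ℤ.+ + a ∣ ⊝ a ≡ i
  spread-restore (+ n)    y       e = +⊝ n
  spread-restore -[1+ k ] (suc y) e with u (suc k) (suc y) in e′
  ... | just _ = ∣-+∣⊝ (<⇒≤ (proj₂ (proj₁ (supp (suc k) (suc y) e′))))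
  restore : ∀ i j {n} → corner u i j ≡ just n → (∣ i ℤ.+ + a ∣ ⊝ a ≡ i) × (∣ j ℤ.+ + a ∣ ⊝ a ≡ j)
  restore i     (+ y)    e = spread-restore i y e , +⊝ y
  restore (+ x) -[1+ y ] e = +⊝ x , ∣-+∣⊝ (<⇒≤ (proj₂ (proj₁ (supp (suc y) (suc x) e))))
  to-ok : ∀ z {n} → time z ≡ just n → grow a u (proj₁ (to z)) (proj₂ (to z)) ≡ just n × from (to z) ≡ z
  to-ok (inj₁ (x , y)) e with (_ , x<) , (_ , y≤) ← supp x y e = trans (inside⇒ x< y≤) e , inside⇒ x< y≤
  to-ok (inj₂ (i , j)) e with corner u i j in ec
  ... | just m rewrite proj₁ (restore i j ec) | proj₂ (restore i j ec) | ec =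
    trans (corner⇒outside u i j ec) e , corner⇒outside u i j ec
  from-ok : ∀ q {n} → grow a u (proj₁ q) (proj₂ q) ≡ just n → time (from q) ≡ just n × to (from q) ≡ q
  from-ok (x , y) = go (x ⊝ a) (y ⊝ a) (∣⊝+∣ x) (∣⊝+∣ y)
    where
    go : ∀ i j {n} → ∣ i ℤ.+ + a ∣ ≡ x → ∣ j ℤ.+ + a ∣ ≡ y → glue (u x y) (s +ₜ corner u i j) i j ≡ just n →
         time (glue (inj₁ (x , y)) (inj₂ (i , j)) i j) ≡ just n × to (glue (inj₁ (x , y)) (inj₂ (i , j)) i j) ≡ (x , y)
    go i        (+ suc m) ei ej e = e , cong₂ _,_ ei ej
    go (+ n)    (+ zero)  ei ej e = e , cong₂ _,_ ei ej
    go -[1+ n ] (+ zero)  ei ej e = e , refl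
    go (+ n)    -[1+ m ]  ei ej e = e , cong₂ _,_ ei ej
    go -[1+ n ] -[1+ m ]  ei ej e = e , refl

counts-quad : ∀ k → Counts (λ (x , y) → quad k x y) (quadSize k)
counts-quad zero    = counts-none
counts-quad (suc k) = counts-grow (quad-supported k) (counts-quad k)

-- Exposed ends of a list of segments.

true≢false : true ≢ false
true≢false ()

∈-keep⁻ : (f : A → Bool) {x : A} (xs : List A) → x ∈ keep f xs → x ∈ xs × f x ≡ true
∈-keep⁻ f (y ∷ xs) x∈ with f y in e
∈-keep⁻ f (y ∷ xs) (here refl) | true  = here refl , e
∈-keep⁻ f (y ∷ xs) (there x∈)  | true  = let x∈′ , fx = ∈-keep⁻ f xs x∈ in there x∈′ , fx
∈-keep⁻ f (y ∷ xs) x∈          | false = let x∈′ , fx = ∈-keep⁻ f xs x∈ in there x∈′ , fx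

∈-keep⁺ : (f : A → Bool) {x : A} (xs : List A) → x ∈ xs → f x ≡ true → x ∈ keep f xs
∈-keep⁺ f (y ∷ xs) x∈ fx with f y in e
∈-keep⁺ f (y ∷ xs) (here refl) fx | true  = here refl
∈-keep⁺ f (y ∷ xs) (there x∈)  fx | true  = there (∈-keep⁺ f xs x∈ fx)
∈-keep⁺ f (y ∷ xs) (here refl) fx | false = ⊥-elim (true≢false (trans (sym fx) e))
∈-keep⁺ f (y ∷ xs) (there x∈)  fx | false = ∈-keep⁺ f xs x∈ fx

keep-all : (xs : List A) → keep (λ _ → true) xs ≡ xs
keep-all []       = refl
keep-all (x ∷ xs) = cong (x ∷_) (keep-all xs)

keep-unique : (f : A → Bool) {xs : List A} → Unique xs → Unique (keep f xs)
keep-unique f {[]}     []         = []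
keep-unique f {x ∷ xs} (x∉ ∷ uxs) with f x
... | true  = All.tabulate (λ y∈ → All.lookup x∉ (proj₁ (∈-keep⁻ f xs y∈))) ∷ keep-unique f uxs
... | false = keep-unique f uxs

-- Only the images that survive the filter need to be told apart.
keep-map-unique : (f : B → Bool) (g : A → B) (key : A → Point) (h : Point → B) → (∀ {p q} → h p ≡ h q → p ≡ q) →
  (xs : List A) → (∀ {x} → x ∈ xs → f (g x) ≡ true → g x ≡ h (key x)) →
  Unique (map key xs) → Unique (keep f (map g xs))
keep-map-unique f g key h h-inj []       eq []         = []
keep-map-unique f g key h h-inj (x ∷ xs) eq (x∉ ∷ uxs) with f (g x) in e
... | false = keep-map-unique f g key h h-inj xs (eq ∘ there) uxs
... | true  = All.tabulate distinct ∷ keep-map-unique f g key h h-inj xs (eq ∘ there) uxs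
  where
  distinct : ∀ {b} → b ∈ keep f (map g xs) → g x ≢ b
  distinct b∈ refl with b∈′ , _ ← ∈-keep⁻ f (map g xs) b∈ with x′ , x′∈ , e′ ← ∈-map⁻ g b∈′ =
    All.lookup x∉ (∈-map⁺ key x′∈)
      (h-inj (trans (sym (eq (here refl) e)) (trans e′ (eq (there x′∈) (trans (cong f (sym e′)) e)))))

==ℤ-refl : ∀ i → (i ==ℤ i) ≡ true
==ℤ-refl i = dec-true (i ℤ.≟ i) refl

touches-end : ∀ {p} s → p ∈ endsOf s → touches p s ≡ true
touches-end (seg (ax , ay) (bx , by)) (here refl)
  rewrite ==ℤ-refl ax | ==ℤ-refl ay = refl
touches-end (seg (ax , ay) (bx , by)) (there (here refl))
  rewrite ==ℤ-refl bx | ==ℤ-refl by = ∨-zeroʳ _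

touchesNone⁻ : ∀ ss {p} → touchesNone ss p ≡ true → ∀ {s} → s ∈ ss → touches p s ≡ false
touchesNone⁻ (s ∷ ss) {p} e (here refl) with touches p s
... | false = refl
touchesNone⁻ (s ∷ ss) {p} e (there s∈) with touches p s
... | false = touchesNone⁻ ss e s∈

touchesNone⁺ : ∀ ss {p} → (∀ {s} → s ∈ ss → touches p s ≡ false) → touchesNone ss p ≡ true
touchesNone⁺ []       none = refl
touchesNone⁺ (s ∷ ss) none rewrite none (here refl) = touchesNone⁺ ss (none ∘ there)

-- The splitting singles out a position, since any other toothpick means any other entry of the
-- list.
record ExposedAt (L : List Seg) (p : Point) (s : Seg) : Set where
  constructor exposedAt
  field
    {before after} : List Seg
    split          : L ≡ before ++ s ∷ after
    isEnd          : p ∈ endsOf s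
    untouched      : ∀ {s′} → s′ ∈ before ++ after → touches p s′ ≡ false

exposedGo⁻ : ∀ pre suf {p s} → (p , s) ∈ exposedGo pre suf →
  ExposedAt (pre ++ suf) p s × s ∈ suf × (∀ {s′} → s′ ∈ pre → touches p s′ ≡ false)
exposedGo⁻ pre (s ∷ suf) ps∈ with ∈-++⁻ (map (λ p → p , s) (keep (touchesNone (pre ++ suf)) (endsOf s))) ps∈
... | inj₁ ps∈ₗ with p , p∈ , refl ← ∈-map⁻ (λ p → p , s) ps∈ₗ
            with p∈′ , e ← ∈-keep⁻ (touchesNone (pre ++ suf)) (endsOf s) p∈ =
      exposedAt refl p∈′ (touchesNone⁻ (pre ++ suf) e) , here refl
      , touchesNone⁻ (pre ++ suf) e ∘ ∈-++⁺ˡ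
... | inj₂ ps∈ᵣ with ex , s∈ , none ← exposedGo⁻ (pre ++ [ s ]) suf ps∈ᵣ =
      subst (λ L → ExposedAt L _ _) (++-assoc pre [ s ] suf) ex , there s∈ , none ∘ ∈-++⁺ˡ

exposedGo⁺ : ∀ pre l {r p s} → p ∈ endsOf s → touchesNone (pre ++ l ++ r) p ≡ true → (p , s) ∈ exposedGo pre (l ++ s ∷ r)
exposedGo⁺ pre []      {r} {p} {s} p∈ e =
  ∈-++⁺ˡ (∈-map⁺ (λ p → p , s) (∈-keep⁺ (touchesNone (pre ++ r)) (endsOf s) p∈ e))
exposedGo⁺ pre (x ∷ l) {r} {p} {s} p∈ e =
  ∈-++⁺ʳ (map (λ p → p , x) (keep (touchesNone (pre ++ l ++ s ∷ r)) (endsOf x)))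
    (exposedGo⁺ (pre ++ [ x ]) l p∈ (trans (cong (λ L → touchesNone L p) (++-assoc pre [ x ] (l ++ r))) e))

exposedEnds⁻ : ∀ L {p s} → (p , s) ∈ exposedEnds L → ExposedAt L p s
exposedEnds⁻ L ps∈ = proj₁ (exposedGo⁻ [] L ps∈)

exposedEnds⁺ : ∀ L {p s} → ExposedAt L p s → (p , s) ∈ exposedEnds L
exposedEnds⁺ L (exposedAt {l} {r} refl p∈ none) = exposedGo⁺ [] l p∈ (touchesNone⁺ (l ++ r) none)

Proper : Seg → Set
Proper s = Seg.end₁ s ≢ Seg.end₂ s

-- An exposed end touches no other entry, so it cannot be an end of one as well; the two ends of a
-- single segment differ by `Proper`.
exposedGo-unique : ∀ pre suf → (∀ {s} → s ∈ suf → Proper s) → Unique (map proj₁ (exposedGo pre suf))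
exposedGo-unique pre []        proper = []
exposedGo-unique pre (s ∷ suf) proper =
  subst Unique (sym (trans (map-++ proj₁ here-part _) (cong (_++ map proj₁ rest) points)))
    (Uniqueₚ.++⁺ (keep-unique (touchesNone (pre ++ suf)) ((proper (here refl) ∷ []) ∷ ([] ∷ [])))
                 (exposedGo-unique (pre ++ [ s ]) suf (proper ∘ there)) disjoint)
  where
  free = keep (touchesNone (pre ++ suf)) (endsOf s)
  here-part = map (λ p → p , s) free
  rest = exposedGo (pre ++ [ s ]) suf
  proj₁-map : ∀ ps → map proj₁ (map (λ (p : Point) → p , s) ps) ≡ ps
  proj₁-map []       = refl
  proj₁-map (p ∷ ps) = cong (p ∷_) (proj₁-map ps)
  points : map proj₁ here-part ≡ free
  points = proj₁-map free
  disjoint : ∀ {p} → p ∈ free × p ∈ map proj₁ rest → ⊥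
  disjoint (p∈ , p∈′) with (p , s′) , ps∈ , refl ← ∈-map⁻ proj₁ p∈′
                      with _ , _ , none ← exposedGo⁻ (pre ++ [ s ]) suf ps∈ =
    true≢false (trans (sym (touches-end s (proj₁ (∈-keep⁻ (touchesNone (pre ++ suf)) (endsOf s) p∈))))
                      (none (∈-++⁺ʳ pre (here refl))))

-- Growth of a list of toothpicks follows the arrival times.

▵-just⁻ : ∀ p q {n} → p ▵ q ≡ just (suc n) → (p ≡ just n × q later-than n) ⊎ (q ≡ just n × p later-than n)
▵-just⁻ (just m) nothing  refl = inj₁ (refl , λ _ ())
▵-just⁻ nothing  (just n) refl = inj₂ (refl , λ _ ())
▵-just⁻ (just m) (just n) e with <-cmp m n
... | tri< m<n _ _ with refl ← trans (sym (clash-< m<n)) e = inj₁ (refl , λ { _ refl → m<n })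
... | tri≈ _ refl _ with () ← trans (sym (clash-diag m)) e
... | tri> _ _ n<m with refl ← trans (sym (trans (clash-comm m n) (clash-< n<m))) e = inj₂ (refl , λ { _ refl → n<m })

-- Both structures are instances. `σ c` is the toothpick centred at `c`, `τ c` its arrival time,
-- `pr₁ p` and `pr₂ p` the possible parents of `p`. `Acc` expresses the filter `ok`, a test of
-- segments, in terms of centres.
module Growth
  (ok : Seg → Bool) (σ : Point → Seg) (τ : Point → Maybe ℕ) (origin : Point)
  (Acc : Point → Set) (pr₁ pr₂ : Point → Point)
  (proper    : ∀ c → Proper (σ c))
  (σ-inj     : ∀ {c d} → σ c ≡ σ d → c ≡ d)
  (pr₁≢      : ∀ p → pr₁ p ≢ p)
  (pr₂≢      : ∀ p → pr₂ p ≢ p)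
  (pr₁≢pr₂   : ∀ p → pr₁ p ≢ pr₂ p)
  (offspring : ∀ c p → p ∈ endsOf (σ c) → ok (perpAt p (σ c)) ≡ true →
               Acc p × perpAt p (σ c) ≡ σ p × (c ≡ pr₁ p ⊎ c ≡ pr₂ p))
  (touching  : ∀ c p → Acc p → touches p (σ c) ≡ true → c ≡ p ⊎ c ≡ pr₁ p ⊎ c ≡ pr₂ p)
  (self      : ∀ p → Acc p → touches p (σ p) ≡ true)
  (bears     : ∀ c p {n} → Acc p → c ≡ pr₁ p ⊎ c ≡ pr₂ p → τ c ≡ just n →
               p ∈ endsOf (σ c) × perpAt p (σ c) ≡ σ p × ok (σ p) ≡ true)
  (rule      : ∀ p → Acc p → p ≢ origin → τ p ≡ τ (pr₁ p) ▵ τ (pr₂ p))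
  (born      : ∀ p {n} → τ p ≡ just (suc n) → Acc p × p ≢ origin)
  (first     : τ origin ≡ just 0)
  (first⁻    : ∀ p → τ p ≡ just 0 → p ≡ origin)
  where

  added : List Seg → List Seg
  added L = keep ok (newPicks L)

  grown : ℕ → List Seg
  grown zero    = [ σ origin ]
  grown (suc n) = grown n ++ added (grown n)

  record Reached (n : ℕ) (L : List Seg) : Set where
    field
      unique   : Unique L
      sound    : ∀ {s} → s ∈ L → ∃ λ c → ∃ λ m → s ≡ σ c × τ c ≡ just m × m ≤ n
      complete : ∀ c {m} → τ c ≡ just m → m ≤ n → σ c ∈ L

  module _ {n L} (R : Reached n L) where
    open Reached R

    lone-parent : ∀ {c d p m} → Acc p → c ≢ d → c ≡ pr₁ p ⊎ c ≡ pr₂ p → d ≡ pr₁ p ⊎ d ≡ pr₂ p →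
      τ p ≡ τ (pr₁ p) ▵ τ (pr₂ p) → τ c ≡ just m → τ d later-than m → τ p ≡ just (suc m)
    lone-parent {m = m} acc c≢d (inj₁ refl) (inj₁ refl) r τc late = ⊥-elim (c≢d refl)
    lone-parent {m = m} acc c≢d (inj₂ refl) (inj₂ refl) r τc late = ⊥-elim (c≢d refl)
    lone-parent {d = d} acc c≢d (inj₁ refl) (inj₂ refl) r τc late =
      trans r (trans (cong (_▵ τ d) τc) (▵-later (τ d) late))
    lone-parent {d = d} acc c≢d (inj₂ refl) (inj₁ refl) r τc late =
      trans r (trans (▵-comm (τ d) _) (trans (cong (_▵ τ d) τc) (▵-later (τ d) late)))

    -- Take an exposed end `p` of `σ c`, with `c` of time `m ≤ n`. The toothpick of the other parent
    -- would touch `p`, so that parent arrives after `n` or never, and the rule gives `p` the time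
    -- `m + 1`. As `σ p` would touch `p` too, this time exceeds `n`, whence `m = n`.
    added-sound : ∀ {s} → s ∈ added L → ∃ λ p → s ≡ σ p × τ p ≡ just (suc n)
    added-sound s∈ with s∈′ , oks ← ∈-keep⁻ ok (newPicks L) s∈ with (p , s′) , ps∈ , refl ← ∈-map⁻ _ s∈′
      with exposedAt {l} {r} refl p∈ none ← exposedEnds⁻ L ps∈
      with c , m , refl , τc , m≤n ← sound (∈-++⁺ʳ l (here refl))
      with acc , perp , c-par ← offspring c p p∈ oks = p , perp , τp
      where
      only-c : ∀ {d m′} → τ d ≡ just m′ → m′ ≤ n → touches p (σ d) ≡ true → d ≡ c
      only-c {d} τd m′≤n t with ∈-++⁻ l (complete d τd m′≤n)
      ... | inj₁ d∈           = ⊥-elim (true≢false (trans (sym t) (none (∈-++⁺ˡ d∈))))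
      ... | inj₂ (here e)     = σ-inj e
      ... | inj₂ (there d∈)   = ⊥-elim (true≢false (trans (sym t) (none (∈-++⁺ʳ l d∈))))
      c≢p : c ≢ p
      c≢p = λ c≡p → [ (λ e → pr₁≢ p (trans (sym e) c≡p)) , (λ e → pr₂≢ p (trans (sym e) c≡p)) ]′ c-par
      not-yet : ∀ {m′} → τ p ≡ just m′ → n < m′
      not-yet τp = ≰⇒> λ m′≤n → c≢p (sym (only-c τp m′≤n (self p acc)))
      p≢origin : p ≢ origin
      p≢origin refl with () ← not-yet first
      late : ∀ d → d ≡ pr₁ p ⊎ d ≡ pr₂ p → d ≢ c → τ d later-than m
      late d d-par d≢c m′ τd = ≤-<-trans m≤n (≰⇒> λ m′≤n →
        d≢c (only-c τd m′≤n (touches-end (σ d) (proj₁ (bears d p acc d-par τd)))))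
      other : ∃ λ d → (d ≡ pr₁ p ⊎ d ≡ pr₂ p) × c ≢ d
      other = go c-par
        where
        go : c ≡ pr₁ p ⊎ c ≡ pr₂ p → ∃ λ d → (d ≡ pr₁ p ⊎ d ≡ pr₂ p) × c ≢ d
        go (inj₁ e) = pr₂ p , inj₂ refl , λ e′ → pr₁≢pr₂ p (trans (sym e) e′)
        go (inj₂ e) = pr₁ p , inj₁ refl , λ e′ → pr₁≢pr₂ p (trans (sym e′) e)
      τp′ : τ p ≡ just (suc m)
      τp′ with d , d-par , c≢d ← other =
        lone-parent acc c≢d c-par d-par (rule p acc p≢origin) τc (late d d-par (c≢d ∘ sym))
      τp : τ p ≡ just (suc n)
      τp = trans τp′ (cong (just ∘ suc) (≤-antisym m≤n (ℕ.s≤s⁻¹ (not-yet τp′))))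

    -- One parent has time `n` and the other comes later or never. Only `p` and its parents carry
    -- toothpicks touching `p`, so in `L` this end of the first parent meets no other entry and is
    -- exposed.
    added-complete : ∀ p → τ p ≡ just (suc n) → σ p ∈ added L
    added-complete p τp with acc , p≢o ← born p τp = from-parent (▵-just⁻ (τ (pr₁ p)) (τ (pr₂ p)) (trans (sym (rule p acc p≢o)) τp))
      where
      by : ∀ c → c ≡ pr₁ p ⊎ c ≡ pr₂ p → τ c ≡ just n →
           (∀ d → d ≡ pr₁ p ⊎ d ≡ pr₂ p → d ≡ c ⊎ τ d later-than n) → σ p ∈ added L
      by c c-par τc others with p∈ , perp , okp ← bears c p acc c-par τc
        with l , r , refl ← ∈-∃++ (complete c τc ≤-refl) =
        ∈-keep⁺ ok (newPicks L) (subst (_∈ newPicks L) perp (∈-map⁺ _ (exposedEnds⁺ L (exposedAt refl p∈ none)))) okp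
        where
        c-once : ∀ l {r} → Unique (l ++ σ c ∷ r) → σ c ∉ l ++ r
        c-once []      (c∉ ∷ _)  c∈         = All.lookup c∉ c∈ refl
        c-once (x ∷ l) (x∉ ∷ _)  (here e)   = All.lookup x∉ (∈-++⁺ʳ l (here refl)) (sym e)
        c-once (x ∷ l) (_ ∷ u)   (there c∈) = c-once l u c∈
        weaken : ∀ {s} → s ∈ l ++ r → s ∈ l ++ σ c ∷ r
        weaken s∈ with ∈-++⁻ l s∈
        ... | inj₁ s∈ₗ = ∈-++⁺ˡ s∈ₗ
        ... | inj₂ s∈ᵣ = ∈-++⁺ʳ l (there s∈ᵣ)
        none : ∀ {s} → s ∈ l ++ r → touches p s ≡ false
        none s∈ with d , m , refl , τd , m≤n ← sound (weaken s∈) = ¬-not λ t → case (touching d p acc t) s∈ τd m≤n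
          where
          parent-case : ∀ {d m} → d ≡ pr₁ p ⊎ d ≡ pr₂ p → σ d ∈ l ++ r → τ d ≡ just m → m ≤ n → ⊥
          parent-case {d} d-par s∈ τd m≤n with others d d-par
          ... | inj₁ refl = c-once l unique s∈
          ... | inj₂ late = <-irrefl refl (<-≤-trans (late _ τd) m≤n)
          case : ∀ {d m} → d ≡ p ⊎ d ≡ pr₁ p ⊎ d ≡ pr₂ p → σ d ∈ l ++ r → τ d ≡ just m → m ≤ n → ⊥
          case (inj₁ refl) s∈ τd m≤n with refl ← trans (sym τd) τp = <-irrefl refl m≤n
          case (inj₂ d-par) s∈ τd m≤n = parent-case d-par s∈ τd m≤n
      from-parent : _ → σ p ∈ added L
      from-parent (inj₁ (τ₁ , late)) = by (pr₁ p) (inj₁ refl) τ₁ λ { d (inj₁ e) → inj₁ e ; d (inj₂ refl) → inj₂ late }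
      from-parent (inj₂ (τ₂ , late)) = by (pr₂ p) (inj₂ refl) τ₂ λ { d (inj₂ e) → inj₁ e ; d (inj₁ refl) → inj₂ late }

    added-unique : Unique (added L)
    added-unique = keep-map-unique ok _ proj₁ σ σ-inj (exposedEnds L) perp
      (exposedGo-unique [] L λ s∈ → let c , _ , e , _ = sound s∈ in subst Proper (sym e) (proper c))
      where
      perp : ∀ {ps} → ps ∈ exposedEnds L → ok (perpAt (proj₁ ps) (proj₂ ps)) ≡ true →
             perpAt (proj₁ ps) (proj₂ ps) ≡ σ (proj₁ ps)
      perp {p , s} ps∈ oks with exposedAt {l} refl p∈ _ ← exposedEnds⁻ L ps∈
                           with c , _ , refl , _ ← sound (∈-++⁺ʳ l (here refl)) =
        proj₁ (proj₂ (offspring c p p∈ oks))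

    reached-suc : Reached (suc n) (L ++ added L)
    reached-suc = record
      { unique   = Uniqueₚ.++⁺ unique added-unique disjoint
      ; sound    = λ s∈ → sound′ (∈-++⁻ L s∈)
      ; complete = λ c τc m≤ → complete′ c τc m≤
      }
      where
      disjoint : ∀ {s} → s ∈ L × s ∈ added L → ⊥
      disjoint (s∈ , s∈′) with c , m , refl , τc , m≤n ← sound s∈ with p , e , τp ← added-sound s∈′
                          with refl ← σ-inj e with refl ← trans (sym τc) τp = <-irrefl refl m≤n
      sound′ : ∀ {s} → s ∈ L ⊎ s ∈ added L → ∃ λ c → ∃ λ m → s ≡ σ c × τ c ≡ just m × m ≤ suc n
      sound′ (inj₁ s∈) = let c , m , e , τc , m≤n = sound s∈ in c , m , e , τc , ≤-trans m≤n (n≤1+n n)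
      sound′ (inj₂ s∈) = let p , e , τp = added-sound s∈ in p , suc n , e , τp , ≤-refl
      complete′ : ∀ c {m} → τ c ≡ just m → m ≤ suc n → σ c ∈ L ++ added L
      complete′ c {m} τc m≤ with m ≤? n
      ... | yes m≤n = ∈-++⁺ˡ (complete c τc m≤n)
      ... | no m≰n with refl ← ≤-antisym m≤ (≰⇒> m≰n) = ∈-++⁺ʳ L (added-complete c τc)

  reached : ∀ n → Reached n (grown n)
  reached zero = record
    { unique   = [] ∷ []
    ; sound    = λ { (here refl) → origin , 0 , refl , first , z≤n }
    ; complete = λ { c τc z≤n → here (cong σ (first⁻ c τc)) }
    }
  reached (suc n) = reached-suc (reached n)

  length-added : ∀ {n size} → LevelSet τ (suc n) size → length (added (grown n)) ≡ size
  length-added {n} S = trans (≤-antisym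
      (unique-⊆⇒length≤ (added-unique (reached n)) λ s∈ →
        let p , e , τp = added-sound (reached n) s∈ in subst (_∈ map σ members) (sym e) (∈-map⁺ σ (complete τp)))
      (unique-⊆⇒length≤ (Uniqueₚ.map⁺ σ-inj unique) λ s∈ →
        let p , p∈ , e = ∈-map⁻ σ s∈ in subst (_∈ added (grown n)) (sym e) (added-complete (reached n) p (sound p∈))))
    (trans (length-map σ members) counted)
    where open LevelSet S

-- Toothpicks as functions of their centres.

-1≡pred : ∀ i → i ℤ.- + 1 ≡ ℤ.pred i
-1≡pred i = ℤₚ.+-comm i (ℤ.- + 1)

+1≡suc : ∀ i → i ℤ.+ + 1 ≡ ℤ.suc i
+1≡suc i = ℤₚ.+-comm i (+ 1)

pred≢suc : ∀ i → ℤ.pred i ≢ ℤ.suc i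
pred≢suc (+ zero) ()
pred≢suc (+ suc n) ()
pred≢suc -[1+ zero ] ()
pred≢suc -[1+ suc n ] ()

pred≢id : ∀ i → ℤ.pred i ≢ i
pred≢id (+ zero) ()
pred≢id (+ suc n) ()
pred≢id -[1+ n ] ()

suc≢id : ∀ i → ℤ.suc i ≢ i
suc≢id (+ n) ()
suc≢id -[1+ zero ] ()
suc≢id -[1+ suc n ] ()

predℤ-injective : ∀ {i j} → ℤ.pred i ≡ ℤ.pred j → i ≡ j
predℤ-injective {i} {j} e = trans (sym (ℤₚ.suc-pred i)) (trans (cong ℤ.suc e) (ℤₚ.suc-pred j))

==ℤ⇒≡ : ∀ i j → (i ==ℤ j) ≡ true → i ≡ j
==ℤ⇒≡ i j e with i ℤ.≟ j
... | yes i≡j = i≡j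

∨-true : ∀ b {c} → b ∨ c ≡ true → b ≡ true ⊎ c ≡ true
∨-true true  e = inj₁ refl
∨-true false e = inj₂ e

double : ∀ i → + 2 ℤ.* i ≡ i ℤ.+ i
double i = trans (ℤₚ.*-distribʳ-+ i (+ 1) (+ 1)) (cong₂ ℤ._+_ (ℤₚ.*-identityˡ i) (ℤₚ.*-identityˡ i))

double-injective : ∀ i j → + 2 ℤ.* i ≡ j ℤ.+ j → i ≡ j
double-injective i j e = ℤₚ.*-cancelˡ-≡ (+ 2) i j (trans e (sym (double j)))

pred+suc : ∀ i → ℤ.pred i ℤ.+ ℤ.suc i ≡ i ℤ.+ i
pred+suc i = begin
  (ℤ.- + 1 ℤ.+ i) ℤ.+ (+ 1 ℤ.+ i) ≡⟨ cong (ℤ._+ (+ 1 ℤ.+ i)) (ℤₚ.+-comm (ℤ.- + 1) i) ⟩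
  (i ℤ.+ ℤ.- + 1) ℤ.+ (+ 1 ℤ.+ i) ≡⟨ ℤₚ.+-assoc i (ℤ.- + 1) (+ 1 ℤ.+ i) ⟩
  i ℤ.+ (ℤ.- + 1 ℤ.+ (+ 1 ℤ.+ i)) ≡⟨ cong (λ j → i ℤ.+ j) (ℤₚ.pred-suc i) ⟩
  i ℤ.+ i                         ∎

vert≡ : ∀ x y → vert (x , y) ≡ seg (x , ℤ.pred y) (x , ℤ.suc y)
vert≡ x y = cong₂ (λ j k → seg (x , j) (x , k)) (-1≡pred y) (+1≡suc y)

horiz≡ : ∀ x y → horiz (x , y) ≡ seg (ℤ.pred x , y) (ℤ.suc x , y)
horiz≡ x y = cong₂ (λ i k → seg (i , y) (k , y)) (-1≡pred x) (+1≡suc x)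

isVertical-vert : ∀ p → isVertical (vert p) ≡ true
isVertical-vert (x , y) = ==ℤ-refl x

isVertical-horiz : ∀ p → isVertical (horiz p) ≡ false
isVertical-horiz (x , y) = dec-false (x ℤ.- + 1 ℤ.≟ x ℤ.+ + 1)
  λ e → pred≢suc x (trans (sym (-1≡pred x)) (trans e (+1≡suc x)))

touches⁻ : ∀ p a b → touches p (seg a b) ≡ true →
  p ≡ a ⊎ p ≡ b ⊎ (+ 2 ℤ.* proj₁ p ≡ proj₁ a ℤ.+ proj₁ b × + 2 ℤ.* proj₂ p ≡ proj₂ a ℤ.+ proj₂ b)
touches⁻ (px , py) (ax , ay) (bx , by) e
  with ∨-true ((px ==ℤ ax) ∧ (py ==ℤ ay)) e
... | inj₁ e₁ = inj₁ (cong₂ _,_ (==ℤ⇒≡ px ax (∧-conicalˡ _ _ e₁)) (==ℤ⇒≡ py ay (∧-conicalʳ (px ==ℤ ax) _ e₁)))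
... | inj₂ e′ with ∨-true ((px ==ℤ bx) ∧ (py ==ℤ by)) e′
...   | inj₁ e₂ = inj₂ (inj₁ (cong₂ _,_ (==ℤ⇒≡ px bx (∧-conicalˡ _ _ e₂)) (==ℤ⇒≡ py by (∧-conicalʳ (px ==ℤ bx) _ e₂))))
...   | inj₂ e₃ = inj₂ (inj₂ (==ℤ⇒≡ (+ 2 ℤ.* px) (ax ℤ.+ bx) (∧-conicalˡ _ _ e₃)
                             , ==ℤ⇒≡ (+ 2 ℤ.* py) (ay ℤ.+ by) (∧-conicalʳ ((+ 2 ℤ.* px) ==ℤ (ax ℤ.+ bx)) _ e₃)))

touches-mid : ∀ p a b → + 2 ℤ.* proj₁ p ≡ proj₁ a ℤ.+ proj₁ b → + 2 ℤ.* proj₂ p ≡ proj₂ a ℤ.+ proj₂ b →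
  touches p (seg a b) ≡ true
touches-mid (px , py) (ax , ay) (bx , by) e e′
  rewrite dec-true (+ 2 ℤ.* px ℤ.≟ ax ℤ.+ bx) e | dec-true (+ 2 ℤ.* py ℤ.≟ ay ℤ.+ by) e′
        | ∨-zeroʳ ((px ==ℤ bx) ∧ (py ==ℤ by)) = ∨-zeroʳ _

-- `v` marks the centres of vertical toothpicks and alternates like a chessboard. The two structures
-- use the two opposite colourings.
module Picks (v : Point → Bool)
  (flip-x : ∀ x y → v (ℤ.suc x , y) ≡ not (v (x , y)))
  (flip-y : ∀ x y → v (x , ℤ.suc y) ≡ not (v (x , y)))
  where

  flip-x⁻ : ∀ x y → v (ℤ.pred x , y) ≡ not (v (x , y))
  flip-x⁻ x y = not-swap (trans (cong (λ i → v (i , y)) (sym (ℤₚ.suc-pred x))) (flip-x (ℤ.pred x) y))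

  flip-y⁻ : ∀ x y → v (x , ℤ.pred y) ≡ not (v (x , y))
  flip-y⁻ x y = not-swap (trans (cong (λ j → v (x , j)) (sym (ℤₚ.suc-pred y))) (flip-y x (ℤ.pred y)))

  pick : Point → Seg
  pick p = if v p then vert p else horiz p

  pr₁ pr₂ : Point → Point
  pr₁ p@(x , y) = if v p then (ℤ.pred x , y) else (x , ℤ.pred y)
  pr₂ p@(x , y) = if v p then (ℤ.suc x , y) else (x , ℤ.suc y)

  Parent : Point → Point → Set
  Parent c p = c ≡ pr₁ p ⊎ c ≡ pr₂ p

  pr₁≢ : ∀ p → pr₁ p ≢ p
  pr₁≢ p@(x , y) with v p
  ... | true  = pred≢id x ∘ cong proj₁
  ... | false = pred≢id y ∘ cong proj₂

  pr₂≢ : ∀ p → pr₂ p ≢ p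
  pr₂≢ p@(x , y) with v p
  ... | true  = suc≢id x ∘ cong proj₁
  ... | false = suc≢id y ∘ cong proj₂

  pr₁≢pr₂ : ∀ p → pr₁ p ≢ pr₂ p
  pr₁≢pr₂ p@(x , y) with v p
  ... | true  = pred≢suc x ∘ cong proj₁
  ... | false = pred≢suc y ∘ cong proj₂

  -- The ends of the toothpick at (x , y) and the midpoint lie on one grid line.
  data Shape : Point → Seg → Set where
    vertical   : ∀ x y → v (x , y) ≡ true  → Shape (x , y) (seg (x , ℤ.pred y) (x , ℤ.suc y))
    horizontal : ∀ x y → v (x , y) ≡ false → Shape (x , y) (seg (ℤ.pred x , y) (ℤ.suc x , y))

  shape : ∀ c → Shape c (pick c)
  shape c@(x , y) with v c in e
  ... | true  = subst (Shape c) (sym (vert≡ x y)) (vertical x y e)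
  ... | false = subst (Shape c) (sym (horiz≡ x y)) (horizontal x y e)

  shape-proper : ∀ {c s} → Shape c s → Proper s
  shape-proper (vertical x y _)   = pred≢suc y ∘ cong proj₂
  shape-proper (horizontal x y _) = pred≢suc x ∘ cong proj₁

  shape-inj : ∀ {c d s} → Shape c s → Shape d s → c ≡ d
  shape-inj C D = go C D refl
    where
    go : ∀ {c d s s′} → Shape c s → Shape d s′ → s ≡ s′ → c ≡ d
    go (vertical x y _)   (vertical x′ y′ _)   e =
      cong₂ _,_ (cong (proj₁ ∘ Seg.end₁) e) (predℤ-injective (cong (proj₂ ∘ Seg.end₁) e))
    go (horizontal x y _) (horizontal x′ y′ _) e =
      cong₂ _,_ (predℤ-injective (cong (proj₁ ∘ Seg.end₁) e)) (cong (proj₂ ∘ Seg.end₁) e)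
    go (vertical x y _)   (horizontal x′ y′ _) e =
      ⊥-elim (pred≢suc x′ (trans (sym (cong (proj₁ ∘ Seg.end₁) e)) (cong (proj₁ ∘ Seg.end₂) e)))
    go (horizontal x y _) (vertical x′ y′ _)   e =
      ⊥-elim (pred≢suc x (trans (cong (proj₁ ∘ Seg.end₁) e) (sym (cong (proj₁ ∘ Seg.end₂) e))))

  pick-inj : ∀ {c d} → pick c ≡ pick d → c ≡ d
  pick-inj {c} {d} e = shape-inj (shape c) (subst (Shape d) (sym e) (shape d))

  end-parent : ∀ {c s p} → Shape c s → p ∈ endsOf s → v p ≡ not (v c) × Parent c p
  end-parent (vertical x y e) (here refl) rewrite flip-y⁻ x y | e = refl , inj₂ (cong (x ,_) (sym (ℤₚ.suc-pred y)))
  end-parent (vertical x y e) (there (here refl)) rewrite flip-y x y | e = refl , inj₁ (cong (x ,_) (sym (ℤₚ.pred-suc y)))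
  end-parent (horizontal x y e) (here refl) rewrite flip-x⁻ x y | e = refl , inj₂ (cong (_, y) (sym (ℤₚ.suc-pred x)))
  end-parent (horizontal x y e) (there (here refl)) rewrite flip-x x y | e = refl , inj₁ (cong (_, y) (sym (ℤₚ.pred-suc x)))

  pick-touching : ∀ c p → touches p (pick c) ≡ true → c ≡ p ⊎ Parent c p
  pick-touching c p t = go (shape c) t
    where
    go : ∀ {c s} → Shape c s → touches p s ≡ true → c ≡ p ⊎ Parent c p
    go S@(vertical x y _) t with touches⁻ p _ _ t
    ... | inj₁ e = inj₂ (proj₂ (end-parent S (here e)))
    ... | inj₂ (inj₁ e) = inj₂ (proj₂ (end-parent S (there (here e))))
    ... | inj₂ (inj₂ (e , e′)) =
      inj₁ (sym (cong₂ _,_ (double-injective (proj₁ p) x e) (double-injective (proj₂ p) y (trans e′ (pred+suc y)))))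
    go S@(horizontal x y _) t with touches⁻ p _ _ t
    ... | inj₁ e = inj₂ (proj₂ (end-parent S (here e)))
    ... | inj₂ (inj₁ e) = inj₂ (proj₂ (end-parent S (there (here e))))
    ... | inj₂ (inj₂ (e , e′)) =
      inj₁ (sym (cong₂ _,_ (double-injective (proj₁ p) x (trans e (pred+suc x))) (double-injective (proj₂ p) y e′)))

  pick-self : ∀ p → touches p (pick p) ≡ true
  pick-self p = go (shape p)
    where
    go : ∀ {p s} → Shape p s → touches p s ≡ true
    go (vertical x y _)   = touches-mid (x , y) _ _ (double x) (trans (double y) (sym (pred+suc y)))
    go (horizontal x y _) = touches-mid (x , y) _ _ (trans (double x) (sym (pred+suc x))) (double y)

  pick-perp : ∀ c p → v p ≡ not (v c) → perpAt p (pick c) ≡ pick p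
  pick-perp c p e rewrite e with v c
  ... | true  rewrite isVertical-vert c  = refl
  ... | false rewrite isVertical-horiz c = refl

  pick-offspring : ∀ c p → p ∈ endsOf (pick c) → perpAt p (pick c) ≡ pick p × Parent c p
  pick-offspring c p p∈ = let e , c-par = end-parent (shape c) p∈ in pick-perp c p e , c-par

  parent-end : ∀ c p → Parent c p → p ∈ endsOf (pick c) × v p ≡ not (v c)
  parent-end c p@(x , y) c-par with v p in e
  parent-end c p@(x , y) (inj₁ refl) | true rewrite flip-x⁻ x y | e =
    there (here (cong (_, y) (sym (trans (+1≡suc (ℤ.pred x)) (ℤₚ.suc-pred x))))) , refl
  parent-end c p@(x , y) (inj₂ refl) | true rewrite flip-x x y | e =
    here (cong (_, y) (sym (trans (-1≡pred (ℤ.suc x)) (ℤₚ.pred-suc x)))) , refl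
  parent-end c p@(x , y) (inj₁ refl) | false rewrite flip-y⁻ x y | e =
    there (here (cong (x ,_) (sym (trans (+1≡suc (ℤ.pred y)) (ℤₚ.suc-pred y))))) , refl
  parent-end c p@(x , y) (inj₂ refl) | false rewrite flip-y x y | e =
    here (cong (x ,_) (sym (trans (-1≡pred (ℤ.suc y)) (ℤₚ.pred-suc y)))) , refl

  pick-bears : ∀ c p → Parent c p → p ∈ endsOf (pick c) × perpAt p (pick c) ≡ pick p
  pick-bears c p c-par = let p∈ , e = parent-end c p c-par in p∈ , pick-perp c p e

-- The toothpick structure as an instance of growth.

par-suc∣∣ : ∀ i → par ∣ ℤ.suc i ∣ ≡ not (par ∣ i ∣)
par-suc∣∣ i = not-swap (trans (cong (λ j → par ∣ j ∣) (sym (ℤₚ.pred-suc i))) (par-pred∣∣ (ℤ.suc i)))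

oddSum : Point → Bool
oddSum (x , y) = par ∣ x ∣ xor par ∣ y ∣

oddSum-suc-x : ∀ x y → oddSum (ℤ.suc x , y) ≡ not (oddSum (x , y))
oddSum-suc-x x y = trans (cong (_xor par ∣ y ∣) (par-suc∣∣ x)) (sym (not-distribˡ-xor (par ∣ x ∣) (par ∣ y ∣)))

oddSum-suc-y : ∀ x y → oddSum (x , ℤ.suc y) ≡ not (oddSum (x , y))
oddSum-suc-y x y = trans (cong (par ∣ x ∣ xor_) (par-suc∣∣ y)) (sym (not-distribʳ-xor (par ∣ x ∣) (par ∣ y ∣)))

xor-true : ∀ a b → a xor b ≡ true → a ≡ not b
xor-true true  b e = sym e
xor-true false b e = cong not (sym e)

xor-false : ∀ a b → a xor b ≡ false → a ≡ b
xor-false true  b e = not-injective (sym e)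
xor-false false b e = sym e

module ToothPicks = Picks (not ∘ oddSum)
  (λ x y → cong not (oddSum-suc-x x y)) (λ x y → cong not (oddSum-suc-y x y))

module CornerPicks = Picks oddSum oddSum-suc-x oddSum-suc-y

toothTime : Pattern → Point → Maybe ℕ
toothTime u (x , y) = spread u ∣ x ∣ ∣ y ∣

-- Reflection in both axes reduces the rule to one quadrant. Apart from the origin, a point on an
-- axis whose parents lie on either side of that axis is empty, as `around` requires.
toothTime-rule : ∀ p → p ≢ (+ 0 , + 0) →
  toothTime quadrant p ≡ toothTime quadrant (ToothPicks.pr₁ p) ▵ toothTime quadrant (ToothPicks.pr₂ p)
toothTime-rule p@(x , y) p≢0 with oddSum p in e
... | false = around (λ m → spread quadrant m ∣ y ∣) x (axis y p≢0 (xor-false _ _ e)) λ n ex →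
      spread-horizontal (quadrant-lawful (2 + n + ∣ y ∣)) n ∣ y ∣ (s≤s (s≤s (m≤m+n n ∣ y ∣))) (m≤n+m ∣ y ∣ (2 + n))
        (trans (cong par (sym ex)) (xor-false _ _ e))
  where
  axis : ∀ y → (x , y) ≢ (+ 0 , + 0) → par ∣ x ∣ ≡ par ∣ y ∣ → ∣ x ∣ ≡ 0 → spread quadrant 0 ∣ y ∣ ≡ nothing
  axis y p≢0 e ex with ∣ y ∣ in ey
  ... | zero        = ⊥-elim (p≢0 (cong₂ _,_ (ℤₚ.∣i∣≡0⇒i≡0 ex) (ℤₚ.∣i∣≡0⇒i≡0 ey)))
  ... | suc zero    with () ← trans (sym e) (cong par ex)
  ... | suc (suc _) = refl
... | true  = around (spread quadrant ∣ x ∣) y (axis (xor-true _ _ e)) λ n ey →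
      spread-vertical (quadrant-lawful (suc (∣ x ∣ + suc n))) ∣ x ∣ n (s≤s (m≤m+n ∣ x ∣ (suc n)))
        (≤-trans (m≤n+m (suc n) ∣ x ∣) (n≤1+n _)) (trans (cong par (sym ey)) (not-swap (xor-true _ _ e)))
  where
  axis : par ∣ x ∣ ≡ not (par ∣ y ∣) → ∣ y ∣ ≡ 0 → spread quadrant ∣ x ∣ 0 ≡ nothing
  axis e ey with ∣ x ∣
  ... | zero  with () ← trans e (cong (not ∘ par) ey)
  ... | suc _ = refl

toothTime-first : ∀ p → toothTime quadrant p ≡ just 0 → p ≡ (+ 0 , + 0)
toothTime-first (+ zero , + zero) e = refl
toothTime-first (+ suc x , + suc y) e with quadrant (suc x) (suc y)
toothTime-first (+ suc x , + suc y) () | just _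
toothTime-first (+ suc x , + suc y) () | nothing
toothTime-first (+ suc x , -[1+ y ]) e with quadrant (suc x) (suc y)
toothTime-first (+ suc x , -[1+ y ]) () | just _
toothTime-first (+ suc x , -[1+ y ]) () | nothing
toothTime-first (-[1+ x ] , + suc y) e with quadrant (suc x) (suc y)
toothTime-first (-[1+ x ] , + suc y) () | just _
toothTime-first (-[1+ x ] , + suc y) () | nothing
toothTime-first (-[1+ x ] , -[1+ y ]) e with quadrant (suc x) (suc y)
toothTime-first (-[1+ x ] , -[1+ y ]) () | just _
toothTime-first (-[1+ x ] , -[1+ y ]) () | nothing
toothTime-first (+ zero , + suc zero) ()
toothTime-first (+ zero , + suc (suc _)) ()
toothTime-first (+ zero , -[1+ zero ]) ()
toothTime-first (+ zero , -[1+ suc _ ]) ()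

toothPick-bears : ∀ c p {n} → ⊤ → ToothPicks.Parent c p → toothTime quadrant c ≡ just n →
  p ∈ endsOf (ToothPicks.pick c) × perpAt p (ToothPicks.pick c) ≡ ToothPicks.pick p × true ≡ true
toothPick-bears c p _ c-par _ = let p∈ , e = ToothPicks.pick-bears c p c-par in p∈ , e , refl

toothTime-born : ∀ p {n} → toothTime quadrant p ≡ just (suc n) → ⊤ × p ≢ (+ 0 , + 0)
toothTime-born p τp = tt , λ { refl → case τp of λ () }

module ToothGrowth = Growth (λ _ → true) ToothPicks.pick (toothTime quadrant) (+ 0 , + 0)
  (λ _ → ⊤) ToothPicks.pr₁ ToothPicks.pr₂
  (λ c → ToothPicks.shape-proper (ToothPicks.shape c))
  ToothPicks.pick-inj ToothPicks.pr₁≢ ToothPicks.pr₂≢ ToothPicks.pr₁≢pr₂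
  (λ c p p∈ _ → tt , ToothPicks.pick-offspring c p p∈)
  (λ c p _ → ToothPicks.pick-touching c p)
  (λ p _ → ToothPicks.pick-self p)
  toothPick-bears
  (λ p _ → toothTime-rule p)
  toothTime-born
  refl
  toothTime-first

-- Stages are numbered from 1, arrival times from 0.
tStruct≡ : ∀ n → tStruct (suc n) ≡ ToothGrowth.grown n
tStruct≡ zero    = refl
tStruct≡ (suc n) = cong₂ _++_ (tStruct≡ n) (trans (cong newPicks (tStruct≡ n)) (sym (keep-all _)))

length-newPicks : ∀ {n size} → LevelSet (toothTime quadrant) (suc n) size → length (newPicks (tStruct (suc n))) ≡ size
length-newPicks {n} S =
  trans (cong length (trans (cong newPicks (tStruct≡ n)) (sym (keep-all _)))) (ToothGrowth.length-added S)

-- The corner structure as an instance of growth.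

-- The first full toothpick is centred at (1 , 0) and arrives at stage 1, so `corner` appears
-- shifted by one and delayed by one. The origin stands for the half-toothpick.
cornerTime : Pattern → Point → Maybe ℕ
cornerTime u (+ zero , + zero)    = just 0
cornerTime u (+ zero , + suc y)   = 1 +ₜ corner u -[1+ 0 ] (+ suc y)
cornerTime u (+ zero , -[1+ y ])  = nothing
cornerTime u (+ suc x , y)        = 1 +ₜ corner u (+ x) y
cornerTime u (-[1+ x ] , y)       = 1 +ₜ corner u -[1+ suc x ] y

-- The complement of the closed third quadrant; `respects-pick` shows that these are the centres of
-- the admissible toothpicks.
accept : Point → Bool
accept (+ suc _ , _) = true
accept (_ , + suc _) = true
accept _             = false

cornerTime-up : ∀ u x y → cornerTime u (x , + suc y) ≡ 1 +ₜ corner u (ℤ.pred x) (+ suc y)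
cornerTime-up u (+ zero)  y = refl
cornerTime-up u (+ suc x) y = refl
cornerTime-up u -[1+ x ]  y = refl

+1-▵ : ∀ {p} q r → p ≡ q ▵ r → 1 +ₜ p ≡ 1 +ₜ q ▵ 1 +ₜ r
+1-▵ q r e = trans (cong (1 +ₜ_) e) (+ₜ-▵ 1 q r)

cornerTime-rule : ∀ p → accept p ≡ true →
  cornerTime quadrant p ≡ cornerTime quadrant (CornerPicks.pr₁ p) ▵ cornerTime quadrant (CornerPicks.pr₂ p)
cornerTime-rule p@(x , y) acc with oddSum p in e
... | true  = h x y acc (xor-true _ _ e)
  where
  u = quadrant
  h : ∀ x y → accept (x , y) ≡ true → par ∣ x ∣ ≡ not (par ∣ y ∣) →
      cornerTime u (x , y) ≡ cornerTime u (ℤ.pred x , y) ▵ cornerTime u (ℤ.suc x , y)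
  h x (+ suc y) _ p = begin
    cornerTime u (x , + suc y)
      ≡⟨ cornerTime-up u x y ⟩
    1 +ₜ corner u (ℤ.pred x) (+ suc y)
      ≡⟨ +1-▵ (corner u (ℤ.pred (ℤ.pred x)) (+ suc y)) (corner u (ℤ.suc (ℤ.pred x)) (+ suc y)) (corner-horizontal-up (quadrant-lawful bound) (ℤ.pred x) y (s≤s (m≤m+n ∣ ℤ.pred x ∣ (suc y)))
               (≤-trans (m≤n+m (suc y) ∣ ℤ.pred x ∣) (n≤1+n _))
               (trans (par-pred∣∣ x) (sym (not-swap p)))) ⟩
    1 +ₜ corner u (ℤ.pred (ℤ.pred x)) (+ suc y) ▵ 1 +ₜ corner u (ℤ.suc (ℤ.pred x)) (+ suc y)
      ≡⟨ cong₂ _▵_ (sym (cornerTime-up u (ℤ.pred x) y))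
           (trans (cong (λ i → 1 +ₜ corner u i (+ suc y)) (trans (ℤₚ.suc-pred x) (sym (ℤₚ.pred-suc x))))
                  (sym (cornerTime-up u (ℤ.suc x) y))) ⟩
    cornerTime u (ℤ.pred x , + suc y) ▵ cornerTime u (ℤ.suc x , + suc y) ∎
    where
    bound = suc (∣ ℤ.pred x ∣ + suc y)
  h (+ suc zero)    (+ zero) _ p = refl
  h (+ suc (suc zero))    (+ zero) _ ()
  h (+ suc (suc (suc x))) (+ zero) _ p = refl
  h (+ suc zero) -[1+ y ] _ p =
    +1-▵ nothing (corner u (+ 1) -[1+ y ]) (corner-horizontal-down (quadrant-lawful (2 + y)) 0 y (s≤s z≤n) ≤-refl (not-injective p))
  h (+ suc (suc x)) -[1+ y ] _ p =
    +1-▵ (corner u (+ x) -[1+ y ]) (corner u (+ (2 + x)) -[1+ y ]) (corner-horizontal-down (quadrant-lawful (2 + (x + y))) (suc x) y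
            (s≤s (s≤s (m≤m+n x y))) (s≤s (s≤s (m≤n+m y x))) (not-injective p))
... | false = h x y acc (xor-false _ _ e)
  where
  u = quadrant
  h : ∀ x y → accept (x , y) ≡ true → par ∣ x ∣ ≡ par ∣ y ∣ →
      cornerTime u (x , y) ≡ cornerTime u (x , ℤ.pred y) ▵ cornerTime u (x , ℤ.suc y)
  h x (+ suc y) _ p = begin
    cornerTime u (x , + suc y)
      ≡⟨ cornerTime-up u x y ⟩
    1 +ₜ corner u (ℤ.pred x) (+ suc y)
      ≡⟨ +1-▵ (corner u (ℤ.pred x) (+ y)) (corner u (ℤ.pred x) (+ (2 + y))) (corner-vertical-up (quadrant-lawful bound) (ℤ.pred x) y (s≤s (m≤m+n ∣ ℤ.pred x ∣ (suc y)))
               (≤-trans (m≤n+m (suc y) ∣ ℤ.pred x ∣) (n≤1+n _))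
               (trans (par-pred∣∣ x) (trans (cong not p) (not-involutive _)))) ⟩
    1 +ₜ corner u (ℤ.pred x) (+ y) ▵ 1 +ₜ corner u (ℤ.pred x) (+ (2 + y))
      ≡⟨ cong₂ _▵_ (below x y p) (sym (cornerTime-up u x (suc y))) ⟩
    cornerTime u (x , + y) ▵ cornerTime u (x , + (2 + y)) ∎
    where
    bound = suc (∣ ℤ.pred x ∣ + suc y)
    below : ∀ x y → par ∣ x ∣ ≡ par (suc y) → 1 +ₜ corner u (ℤ.pred x) (+ y) ≡ cornerTime u (x , + y)
    below x         (suc y) _ = sym (cornerTime-up u x y)
    below (+ suc x) zero    _ = refl
    below -[1+ x ]  zero    _ = refl
  h (+ suc (suc x)) (+ zero) _ p = +1-▵ (corner u (+ suc x) -[1+ 0 ]) (corner u (+ suc x) (+ 1)) (corner-vertical-axis (quadrant-lawful 0) x)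
  h (+ suc x) -[1+ y ] _ p =
    +1-▵ (corner u (+ x) (ℤ.pred -[1+ y ])) (corner u (+ x) (ℤ.suc -[1+ y ])) (corner-vertical-down (quadrant-lawful (2 + (x + y))) x y
            (s≤s (≤-trans (m≤m+n x y) (n≤1+n _))) (s≤s (s≤s (m≤n+m y x))) (not-injective p))

cornerTime-first : ∀ p → cornerTime quadrant p ≡ just 0 → p ≡ (+ 0 , + 0)
cornerTime-first (+ zero , + zero) e = refl
cornerTime-first (+ zero , + suc y) e with corner quadrant -[1+ 0 ] (+ suc y)
cornerTime-first (+ zero , + suc y) () | just _
cornerTime-first (+ zero , + suc y) () | nothing
cornerTime-first (+ suc x , y) e with corner quadrant (+ x) y
cornerTime-first (+ suc x , y) () | just _
cornerTime-first (+ suc x , y) () | nothing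
cornerTime-first (-[1+ x ] , y) e with corner quadrant -[1+ suc x ] y
cornerTime-first (-[1+ x ] , y) () | just _
cornerTime-first (-[1+ x ] , y) () | nothing

cornerTime-accept : ∀ p {n} → cornerTime quadrant p ≡ just (suc n) → accept p ≡ true
cornerTime-accept (+ zero , + suc y)   e = refl
cornerTime-accept (+ suc x , y)        e = refl
cornerTime-accept (-[1+ x ] , + suc y) e = refl

module CP = CornerPicks

s₀ : Seg
s₀ = seg (+ 0 , + 0) (+ 1 , + 0)

cornerSeg : Point → Seg
cornerSeg (+ zero , + zero) = s₀
cornerSeg p                 = CP.pick p

origin? : ∀ p → p ≡ (+ 0 , + 0) ⊎ (p ≢ (+ 0 , + 0) × cornerSeg p ≡ CP.pick p)
origin? (+ zero  , + zero)   = inj₁ refl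
origin? (+ zero  , + suc _)  = inj₂ ((λ ()) , refl)
origin? (+ zero  , -[1+ _ ]) = inj₂ ((λ ()) , refl)
origin? (+ suc _ , _)        = inj₂ ((λ ()) , refl)
origin? (-[1+ _ ] , _)       = inj₂ ((λ ()) , refl)

respects-vertical : ∀ x y → respects (seg (x , ℤ.pred y) (x , ℤ.suc y)) ≡ accept (x , y)
respects-vertical x y rewrite ==ℤ-refl x = go x y
  where
  go : ∀ x y → not ((minℤ x x <ℤ + 0) ∧ (minℤ (ℤ.pred y) (ℤ.suc y) <ℤ + 0))
             ∧ not ((x <ℤ + 0) ∧ (minℤ (ℤ.pred y) (ℤ.suc y) <ℤ + 0) ∧ (+ 0 <ℤ maxℤ (ℤ.pred y) (ℤ.suc y)))
             ∧ not ((x ==ℤ + 0) ∧ (minℤ (ℤ.pred y) (ℤ.suc y) <ℤ + 0)) ≡ accept (x , y)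
  go (+ zero)  (+ zero)       = refl
  go (+ zero)  (+ suc y)      = refl
  go (+ zero)  -[1+ zero ]    = refl
  go (+ zero)  -[1+ suc y ]   = refl
  go (+ suc x) (+ zero)       = refl
  go (+ suc x) (+ suc y)      = refl
  go (+ suc x) -[1+ zero ]    = refl
  go (+ suc x) -[1+ suc y ]   = refl
  go -[1+ x ]  (+ zero)       = refl
  go -[1+ x ]  (+ suc y)      = refl
  go -[1+ x ]  -[1+ zero ]    = refl
  go -[1+ x ]  -[1+ suc y ]   = refl

respects-horizontal : ∀ x y → respects (seg (ℤ.pred x , y) (ℤ.suc x , y)) ≡ accept (x , y)
respects-horizontal x y rewrite dec-false (ℤ.pred x ℤ.≟ ℤ.suc x) (pred≢suc x) = go x y
  where
  go : ∀ x y → not ((minℤ (ℤ.pred x) (ℤ.suc x) <ℤ + 0) ∧ (minℤ y y <ℤ + 0))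
             ∧ not ((y ==ℤ + 0) ∧ (minℤ (ℤ.pred x) (ℤ.suc x) <ℤ + 0))
             ∧ not ((y <ℤ + 0) ∧ (minℤ (ℤ.pred x) (ℤ.suc x) <ℤ + 0) ∧ (+ 0 <ℤ maxℤ (ℤ.pred x) (ℤ.suc x))) ≡ accept (x , y)
  go (+ zero)     (+ zero)  = refl
  go (+ zero)     (+ suc y) = refl
  go (+ zero)     -[1+ y ]  = refl
  go (+ suc x)    (+ zero)  = refl
  go (+ suc x)    (+ suc y) = refl
  go (+ suc x)    -[1+ y ]  = refl
  go -[1+ zero ]  (+ zero)  = refl
  go -[1+ zero ]  (+ suc y) = refl
  go -[1+ zero ]  -[1+ y ]  = refl
  go -[1+ suc x ] (+ zero)  = refl
  go -[1+ suc x ] (+ suc y) = refl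
  go -[1+ suc x ] -[1+ y ]  = refl

respects-pick : ∀ p → respects (CP.pick p) ≡ accept p
respects-pick p = go (CP.shape p)
  where
  go : ∀ {p s} → CP.Shape p s → respects s ≡ accept p
  go (CP.vertical x y _)   = respects-vertical x y
  go (CP.horizontal x y _) = respects-horizontal x y

cornerSeg-accepted : ∀ p → accept p ≡ true → cornerSeg p ≡ CP.pick p
cornerSeg-accepted p acc with origin? p
... | inj₁ refl    = case acc of λ ()
... | inj₂ (_ , e) = e

cornerSeg-proper : ∀ c → Proper (cornerSeg c)
cornerSeg-proper c with origin? c
... | inj₁ refl = λ ()
... | inj₂ (_ , e) rewrite e = CP.shape-proper (CP.shape c)

s₀≢pick : ∀ c → s₀ ≢ CP.pick c
s₀≢pick c e = go (CP.shape c) e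
  where
  go : ∀ {c s} → CP.Shape c s → s₀ ≢ s
  go (CP.vertical x y _)            e with () ← trans (cong (proj₁ ∘ Seg.end₁) e) (sym (cong (proj₁ ∘ Seg.end₂) e))
  go (CP.horizontal (+ suc zero) y _) ()
  go (CP.horizontal (+ zero) y _)  ()
  go (CP.horizontal (+ suc (suc x)) y _) ()
  go (CP.horizontal -[1+ x ] y _)  ()

cornerSeg-inj : ∀ {c d} → cornerSeg c ≡ cornerSeg d → c ≡ d
cornerSeg-inj {c} {d} e with origin? c | origin? d
... | inj₁ refl     | inj₁ refl     = refl
... | inj₁ refl     | inj₂ (_ , e′) = ⊥-elim (s₀≢pick d (trans e e′))
... | inj₂ (_ , e′) | inj₁ refl     = ⊥-elim (s₀≢pick c (trans (sym e) e′))
... | inj₂ (_ , e₁) | inj₂ (_ , e₂) = CP.pick-inj (trans (sym e₁) (trans e e₂))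

cornerSeg-offspring : ∀ c p → p ∈ endsOf (cornerSeg c) → respects (perpAt p (cornerSeg c)) ≡ true →
  accept p ≡ true × perpAt p (cornerSeg c) ≡ cornerSeg p × CP.Parent c p
cornerSeg-offspring c p p∈ r with origin? c
cornerSeg-offspring c p (here refl)         () | inj₁ refl
cornerSeg-offspring c p (there (here refl)) r  | inj₁ refl = refl , refl , inj₁ refl
cornerSeg-offspring c p p∈ r | inj₂ (_ , e) rewrite e with perp , c-par ← CP.pick-offspring c p p∈ =
  acc , trans perp (sym (cornerSeg-accepted p acc)) , c-par
  where
  acc : accept p ≡ true
  acc = trans (sym (respects-pick p)) (trans (cong respects (sym perp)) r)

cornerSeg-touching : ∀ c p → accept p ≡ true → touches p (cornerSeg c) ≡ true → c ≡ p ⊎ CP.Parent c p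
cornerSeg-touching c p acc t with origin? c
... | inj₂ (_ , e) rewrite e = CP.pick-touching c p t
... | inj₁ refl with touches⁻ p _ _ t
...   | inj₁ refl                  = inj₁ refl
...   | inj₂ (inj₁ refl)           = inj₂ (inj₁ refl)
-- The midpoint of the half-toothpick is no lattice point: its doubled abscissa is 1, which is odd.
...   | inj₂ (inj₂ (e , e′))       = ⊥-elim (no-midpoint (proj₁ p) e)
  where
  no-midpoint : ∀ i → + 2 ℤ.* i ≢ + 1
  no-midpoint i e with () ← trans (sym (par-double ∣ i ∣))
    (cong par (trans (cong (λ n → ∣ i ∣ + n) (sym (+-identityʳ ∣ i ∣))) (trans (sym (ℤₚ.abs-* (+ 2) i)) (cong ∣_∣ e))))

-- The half-toothpick ends only at the origin and at (1 , 0), so the origin must have no other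
-- child. The neighbours to the left and below are not accepted, and (0 , 1) would carry a vertical
-- toothpick, whose parents lie to its left and right.
child-of-origin : ∀ p → accept p ≡ true → CP.Parent (+ 0 , + 0) p → p ≡ (+ 1 , + 0)
child-of-origin p@(x , y) acc par with oddSum p in e
child-of-origin p@(x , y) acc (inj₁ e′) | true =
  cong₂ _,_ (trans (sym (ℤₚ.suc-pred x)) (cong (ℤ.suc ∘ proj₁) (sym e′))) (cong proj₂ (sym e′))
child-of-origin p@(x , y) acc (inj₂ e′) | true
  with refl ← cong proj₂ e′
  with refl ← trans (sym (ℤₚ.pred-suc x)) (cong (ℤ.pred ∘ proj₁) (sym e′)) with () ← acc
child-of-origin p@(x , y) acc (inj₁ e′) | false
  with refl ← cong proj₁ e′
  with refl ← trans (sym (ℤₚ.suc-pred y)) (cong (ℤ.suc ∘ proj₂) (sym e′)) with () ← e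
child-of-origin p@(x , y) acc (inj₂ e′) | false
  with refl ← cong proj₁ e′
  with refl ← trans (sym (ℤₚ.pred-suc y)) (cong (ℤ.pred ∘ proj₂) (sym e′)) with () ← acc

cornerSeg-self : ∀ p → accept p ≡ true → touches p (cornerSeg p) ≡ true
cornerSeg-self p acc = trans (cong (touches p) (cornerSeg-accepted p acc)) (CP.pick-self p)

cornerSeg-bears : ∀ c p {n} → accept p ≡ true → CP.Parent c p → cornerTime quadrant c ≡ just n →
  p ∈ endsOf (cornerSeg c) × perpAt p (cornerSeg c) ≡ cornerSeg p × respects (cornerSeg p) ≡ true
cornerSeg-bears c p acc c-par _ with origin? c
... | inj₁ refl with refl ← child-of-origin p acc c-par = there (here refl) , refl , refl
... | inj₂ (_ , e) rewrite e | cornerSeg-accepted p acc with p∈ , perp ← CP.pick-bears c p c-par =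
  p∈ , perp , trans (respects-pick p) acc

cornerTime-born : ∀ p {n} → cornerTime quadrant p ≡ just (suc n) → accept p ≡ true × p ≢ (+ 0 , + 0)
cornerTime-born p τp = cornerTime-accept p τp , λ { refl → case τp of λ () }

module CornerGrowth = Growth respects cornerSeg (cornerTime quadrant) (+ 0 , + 0)
  (λ p → accept p ≡ true) CP.pr₁ CP.pr₂
  cornerSeg-proper cornerSeg-inj CP.pr₁≢ CP.pr₂≢ CP.pr₁≢pr₂
  cornerSeg-offspring cornerSeg-touching cornerSeg-self cornerSeg-bears
  (λ p acc _ → cornerTime-rule p acc)
  cornerTime-born
  refl cornerTime-first

cStruct≡ : ∀ n → cStruct n ≡ CornerGrowth.grown n
cStruct≡ zero    = refl
cStruct≡ (suc n) = cong (λ L → L ++ newCorner L) (cStruct≡ n)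

length-newCorner : ∀ {n size} → LevelSet (cornerTime quadrant) (suc n) size → length (newCorner (cStruct n)) ≡ size
length-newCorner {n} S = trans (cong (length ∘ newCorner) (cStruct≡ n)) (CornerGrowth.length-added S)

-- Stage counts of the two structures.

toothSize : (ℕ → ℕ) → ℕ → ℕ
toothSize f n = δ n + (delay 1 δ n + (delay 1 δ n +
  (delay 1 f n + (delay 1 f n + (delay 1 f n + delay 1 f n)))))

module _ {u : Pattern} {f : ℕ → ℕ} (positive : ∀ x y {n} → u x y ≡ just n → 0 < x × 0 < y)
         (counts : Counts {ℕ × ℕ} (λ (x , y) → u x y) f) where

  counts-cornerTime : Counts (cornerTime u) (λ n → δ n + delay 1 (cornerSize f) n)
  counts-cornerTime =
    counts-transport to from to-ok from-ok (counts-⊎ counts-point (counts-+ₜ 1 (counts-corner positive counts)))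
    where
    to : ⊤ ⊎ (ℤ × ℤ) → ℤ × ℤ
    to (inj₁ tt)      = + 0 , + 0
    to (inj₂ (i , j)) = ℤ.suc i , j
    from : ℤ × ℤ → ⊤ ⊎ (ℤ × ℤ)
    from (+ zero , + zero)   = inj₁ tt
    from (+ zero , + suc y)  = inj₂ (-[1+ 0 ] , + suc y)
    from (+ zero , -[1+ y ]) = inj₁ tt
    from (+ suc x , y)       = inj₂ (+ x , y)
    from (-[1+ x ] , y)      = inj₂ (-[1+ suc x ] , y)
    time : ⊤ ⊎ (ℤ × ℤ) → Maybe ℕ
    time = [ (λ _ → just 0) , (λ (i , j) → 1 +ₜ corner u i j) ]′
    to-ok : ∀ z {n} → time z ≡ just n → cornerTime u (to z) ≡ just n × from (to z) ≡ z
    to-ok (inj₁ tt) e = e , refl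
    to-ok (inj₂ (+ x , y)) e = e , refl
    to-ok (inj₂ (-[1+ zero ] , + suc y)) e = e , refl
    to-ok (inj₂ (-[1+ suc x ] , y)) e = e , refl
    from-ok : ∀ q {n} → cornerTime u q ≡ just n → time (from q) ≡ just n × to (from q) ≡ q
    from-ok (+ zero , + zero) e = e , refl
    from-ok (+ zero , + suc y) e = e , refl
    from-ok (+ suc x , y) e = e , refl
    from-ok (-[1+ x ] , y) e = e , refl

  counts-toothTime : Counts (toothTime u) (toothSize f)
  counts-toothTime =
    counts-transport to from to-ok from-ok
      (counts-⊎ counts-point (counts-⊎ (counts-+ₜ 1 counts-point) (counts-⊎ (counts-+ₜ 1 counts-point)
        (counts-⊎ quarter (counts-⊎ quarter (counts-⊎ quarter quarter))))))
    where
    quarter = counts-+ₜ 1 counts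
    Piece : Set
    Piece = ⊤ ⊎ (⊤ ⊎ (⊤ ⊎ ((ℕ × ℕ) ⊎ ((ℕ × ℕ) ⊎ ((ℕ × ℕ) ⊎ (ℕ × ℕ))))))
    pattern pt₀ = inj₁ tt
    pattern pt₁ = inj₂ (inj₁ tt)
    pattern pt₂ = inj₂ (inj₂ (inj₁ tt))
    pattern ne x y = inj₂ (inj₂ (inj₂ (inj₁ (x , y))))
    pattern nw x y = inj₂ (inj₂ (inj₂ (inj₂ (inj₁ (x , y)))))
    pattern se x y = inj₂ (inj₂ (inj₂ (inj₂ (inj₂ (inj₁ (x , y))))))
    pattern sw x y = inj₂ (inj₂ (inj₂ (inj₂ (inj₂ (inj₂ (x , y))))))
    to : Piece → ℤ × ℤ
    to pt₀      = + 0 , + 0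
    to pt₁      = + 0 , + 1
    to pt₂      = + 0 , -[1+ 0 ]
    to (ne x y) = + x , + y
    to (nw x y) = ℤ.- (+ x) , + y
    to (se x y) = + x , ℤ.- (+ y)
    to (sw x y) = ℤ.- (+ x) , ℤ.- (+ y)
    from : ℤ × ℤ → Piece
    from (+ suc x , + y)       = ne (suc x) y
    from (+ suc x , -[1+ y ])  = se (suc x) (suc y)
    from (-[1+ x ] , + y)      = nw (suc x) y
    from (-[1+ x ] , -[1+ y ]) = sw (suc x) (suc y)
    from (+ zero , + zero)     = pt₀
    from (+ zero , + suc y)    = pt₁
    from (+ zero , -[1+ y ])   = pt₂
    time : Piece → Maybe ℕ
    time = [ (λ _ → just 0) , [ (λ _ → just 1) , [ (λ _ → just 1) , [ q , [ q , [ q , q ]′ ]′ ]′ ]′ ]′ ]′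
      where
      q : ℕ × ℕ → Maybe ℕ
      q (x , y) = 1 +ₜ u x y
    positive₁ : ∀ x y {n} → 1 +ₜ u x y ≡ just n → 0 < x × 0 < y
    positive₁ x y e with u x y in e′
    ... | just m = positive x y e′
    to-ok : ∀ z {n} → time z ≡ just n → toothTime u (to z) ≡ just n × from (to z) ≡ z
    to-ok pt₀ e = e , refl
    to-ok pt₁ e = e , refl
    to-ok pt₂ e = e , refl
    to-ok (ne x y) e with positive₁ x y e
    to-ok (ne (suc x) (suc y)) e | _ = e , refl
    to-ok (ne (suc x) zero)    e | _ , ()
    to-ok (nw x y) e with positive₁ x y e
    to-ok (nw (suc x) (suc y)) e | _ = e , refl
    to-ok (nw (suc x) zero)    e | _ , ()
    to-ok (se x y) e with positive₁ x y e
    to-ok (se (suc x) (suc y)) e | _ = e , refl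
    to-ok (se (suc x) zero)    e | _ , ()
    to-ok (sw x y) e with positive₁ x y e
    to-ok (sw (suc x) (suc y)) e | _ = e , refl
    to-ok (sw (suc x) zero)    e | _ , ()
    from-ok : ∀ q {n} → toothTime u q ≡ just n → time (from q) ≡ just n × to (from q) ≡ q
    from-ok (+ suc x , + suc y)    e = e , refl
    from-ok (+ suc x , -[1+ y ])   e = e , refl
    from-ok (-[1+ x ] , + suc y)   e = e , refl
    from-ok (-[1+ x ] , -[1+ y ])  e = e , refl
    from-ok (+ zero , + zero)      e = e , refl
    from-ok (+ zero , + suc zero)  e = e , refl
    from-ok (+ zero , -[1+ zero ]) e = e , refl

-- Points outside block `n` arrive at `2 ^ suc n - 1` or later, which is after `n`; the diagonal
-- therefore counts the limit pattern.
quadrantSize : ℕ → ℕ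
quadrantSize n = quadSize n n

quadrant-level : ∀ k {n} → n ≤ k → LevelSet (λ (x , y) → quadrant x y) n (quadSize k n)
quadrant-level k {n} n≤k = record
  { members = members ; unique = unique ; counted = counted
  ; sound    = λ { {x , y} q∈ → quad⇒quadrant k x y (sound q∈) }
  ; complete = λ { {x , y} e → complete (quadrant⇒quad k x y (≤-<-trans (s≤s n≤k) (n<2^n (suc k))) e) }
  }
  where open LevelSet (counts-quad k n)

counts-quadrant : Counts (λ (x , y) → quadrant x y) quadrantSize
counts-quadrant n = quadrant-level n ≤-refl

quadrantSize≡ : ∀ {k n} → n ≤ k → quadrantSize n ≡ quadSize k n
quadrantSize≡ {k} {n} n≤k = counts-unique (counts-quadrant n) (quadrant-level k n≤k)

quadrant-positive : ∀ x y {n} → quadrant x y ≡ just n → 0 < x × 0 < y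
quadrant-positive x y e = let (x> , _) , (y> , _) = quad-supported (x + y) x y e in x> , y>

c-suc : ∀ n → c (suc n) ≡ cornerSize quadrantSize n
c-suc n = length-newCorner (counts-cornerTime quadrant-positive counts-quadrant (suc n))

t-suc : ∀ n → t (suc n) ≡ toothSize quadrantSize n
t-suc zero    = refl
t-suc (suc n) = length-newPicks (counts-toothTime quadrant-positive counts-quadrant (suc n))

-- Formal power series as a commutative semiring.

tail : Series → Series
tail f n = f (suc n)

sumTo-suc : ∀ f n → sumTo f (suc n) ≡ f 0 ℤ.+ sumTo (f ∘ suc) n
sumTo-suc f zero    = refl
sumTo-suc f (suc n) = trans (cong (ℤ._+ f (2 ℕ.+ n)) (sumTo-suc f n)) (ℤₚ.+-assoc (f 0) _ _)

⊛-suc : ∀ f g n → (f ⊛ g) (suc n) ≡ f 0 ℤ.* g (suc n) ℤ.+ (tail f ⊛ g) n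
⊛-suc f g n = sumTo-suc (λ i → f i ℤ.* g (suc n ℕ.∸ i)) n

-- Splitting the convolution at its other end; played against `⊛-suc`, this makes commutativity an
-- induction.
⊛-suc′ : ∀ f g n → (f ⊛ g) (suc n) ≡ (f ⊛ tail g) n ℤ.+ f (suc n) ℤ.* g 0
⊛-suc′ f g zero    = refl
⊛-suc′ f g (suc n) = begin
  (f ⊛ g) (2 ℕ.+ n)
    ≡⟨ ⊛-suc f g (suc n) ⟩
  f 0 ℤ.* g (2 ℕ.+ n) ℤ.+ (tail f ⊛ g) (suc n)
    ≡⟨ cong (λ z → f 0 ℤ.* g (2 ℕ.+ n) ℤ.+ z) (⊛-suc′ (tail f) g n) ⟩
  f 0 ℤ.* g (2 ℕ.+ n) ℤ.+ ((tail f ⊛ tail g) n ℤ.+ f (2 ℕ.+ n) ℤ.* g 0)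
    ≡⟨ ℤₚ.+-assoc (f 0 ℤ.* g (2 ℕ.+ n)) _ _ ⟨
  f 0 ℤ.* g (2 ℕ.+ n) ℤ.+ (tail f ⊛ tail g) n ℤ.+ f (2 ℕ.+ n) ℤ.* g 0
    ≡⟨ cong (ℤ._+ f (2 ℕ.+ n) ℤ.* g 0) (⊛-suc f (tail g) n) ⟨
  (f ⊛ tail g) (suc n) ℤ.+ f (2 ℕ.+ n) ℤ.* g 0 ∎

⊛-cong : ∀ {f f′ g g′} → f ≐ f′ → g ≐ g′ → f ⊛ g ≐ f′ ⊛ g′
⊛-cong {f} {f′} {g} {g′} f≐ g≐ zero    = cong₂ ℤ._*_ (f≐ 0) (g≐ 0)
⊛-cong {f} {f′} {g} {g′} f≐ g≐ (suc n) = begin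
  (f ⊛ g) (suc n)                               ≡⟨ ⊛-suc f g n ⟩
  f 0 ℤ.* g (suc n) ℤ.+ (tail f ⊛ g) n          ≡⟨ cong₂ ℤ._+_ (cong₂ ℤ._*_ (f≐ 0) (g≐ (suc n))) (⊛-cong (f≐ ∘ suc) g≐ n) ⟩
  f′ 0 ℤ.* g′ (suc n) ℤ.+ (tail f′ ⊛ g′) n      ≡⟨ ⊛-suc f′ g′ n ⟨
  (f′ ⊛ g′) (suc n)                             ∎

-- A coefficient of a product sees finitely many coefficients of its factors, which lets a partial
-- product stand in for the limit.
⊛-cong-upTo : ∀ f {g g′} n → (∀ i → i ≤ n → g i ≡ g′ i) → (f ⊛ g) n ≡ (f ⊛ g′) n
⊛-cong-upTo f zero    g≐ = cong (f 0 ℤ.*_) (g≐ 0 z≤n)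
⊛-cong-upTo f {g} {g′} (suc n) g≐ = begin
  (f ⊛ g) (suc n)                       ≡⟨ ⊛-suc f g n ⟩
  f 0 ℤ.* g (suc n) ℤ.+ (tail f ⊛ g) n  ≡⟨ cong₂ ℤ._+_ (cong (f 0 ℤ.*_) (g≐ (suc n) ≤-refl))
                                             (⊛-cong-upTo (tail f) n λ i i≤n → g≐ i (≤-trans i≤n (ℕₚ.n≤1+n n))) ⟩
  f 0 ℤ.* g′ (suc n) ℤ.+ (tail f ⊛ g′) n ≡⟨ ⊛-suc f g′ n ⟨
  (f ⊛ g′) (suc n)                      ∎

⊛-comm : ∀ f g → f ⊛ g ≐ g ⊛ f
⊛-comm f g zero    = ℤₚ.*-comm (f 0) (g 0)
⊛-comm f g (suc n) = begin
  (f ⊛ g) (suc n)                       ≡⟨ ⊛-suc f g n ⟩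
  f 0 ℤ.* g (suc n) ℤ.+ (tail f ⊛ g) n  ≡⟨ cong₂ ℤ._+_ (ℤₚ.*-comm (f 0) (g (suc n))) (⊛-comm (tail f) g n) ⟩
  g (suc n) ℤ.* f 0 ℤ.+ (g ⊛ tail f) n  ≡⟨ ℤₚ.+-comm (g (suc n) ℤ.* f 0) _ ⟩
  (g ⊛ tail f) n ℤ.+ g (suc n) ℤ.* f 0  ≡⟨ ⊛-suc′ g f n ⟨
  (g ⊛ f) (suc n)                       ∎

𝟘 : Series
𝟘 _ = + 0

⊛-zeroˡ : ∀ f → 𝟘 ⊛ f ≐ 𝟘
⊛-zeroˡ f zero    = ℤₚ.*-zeroˡ (f 0)
⊛-zeroˡ f (suc n) = trans (⊛-suc 𝟘 f n) (cong₂ ℤ._+_ (ℤₚ.*-zeroˡ (f (suc n))) (⊛-zeroˡ f n))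

⊛-identityˡ : ∀ f → 𝟙 ⊛ f ≐ f
⊛-identityˡ f zero    = ℤₚ.*-identityˡ (f 0)
⊛-identityˡ f (suc n) = trans (⊛-suc 𝟙 f n)
  (trans (cong₂ ℤ._+_ (ℤₚ.*-identityˡ (f (suc n))) (⊛-zeroˡ f n)) (ℤₚ.+-identityʳ (f (suc n))))

⊛-distribʳ-⊕ : ∀ h f g → (f ⊕ g) ⊛ h ≐ f ⊛ h ⊕ g ⊛ h
⊛-distribʳ-⊕ h f g zero    = ℤₚ.*-distribʳ-+ (h 0) (f 0) (g 0)
⊛-distribʳ-⊕ h f g (suc n) = begin
  ((f ⊕ g) ⊛ h) (suc n)
    ≡⟨ ⊛-suc (f ⊕ g) h n ⟩
  (f 0 ℤ.+ g 0) ℤ.* h (suc n) ℤ.+ ((tail f ⊕ tail g) ⊛ h) n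
    ≡⟨ cong (λ z → (f 0 ℤ.+ g 0) ℤ.* h (suc n) ℤ.+ z) (⊛-distribʳ-⊕ h (tail f) (tail g) n) ⟩
  (f 0 ℤ.+ g 0) ℤ.* h (suc n) ℤ.+ ((tail f ⊛ h) n ℤ.+ (tail g ⊛ h) n)
    ≡⟨ rearrange (f 0) (g 0) (h (suc n)) _ _ ⟩
  (f 0 ℤ.* h (suc n) ℤ.+ (tail f ⊛ h) n) ℤ.+ (g 0 ℤ.* h (suc n) ℤ.+ (tail g ⊛ h) n)
    ≡⟨ cong₂ ℤ._+_ (⊛-suc f h n) (⊛-suc g h n) ⟨
  (f ⊛ h ⊕ g ⊛ h) (suc n) ∎
  where
  rearrange : ∀ a b c d e → (a ℤ.+ b) ℤ.* c ℤ.+ (d ℤ.+ e) ≡ (a ℤ.* c ℤ.+ d) ℤ.+ (b ℤ.* c ℤ.+ e)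
  rearrange = solve-∀

⊛-scale : ∀ a f g → (λ n → a ℤ.* f n) ⊛ g ≐ (λ n → a ℤ.* (f ⊛ g) n)
⊛-scale a f g zero    = ℤₚ.*-assoc a (f 0) (g 0)
⊛-scale a f g (suc n) = begin
  ((λ n → a ℤ.* f n) ⊛ g) (suc n)
    ≡⟨ ⊛-suc (λ n → a ℤ.* f n) g n ⟩
  a ℤ.* f 0 ℤ.* g (suc n) ℤ.+ ((λ n → a ℤ.* tail f n) ⊛ g) n
    ≡⟨ cong₂ ℤ._+_ (ℤₚ.*-assoc a (f 0) (g (suc n))) (⊛-scale a (tail f) g n) ⟩
  a ℤ.* (f 0 ℤ.* g (suc n)) ℤ.+ a ℤ.* (tail f ⊛ g) n
    ≡⟨ ℤₚ.*-distribˡ-+ a (f 0 ℤ.* g (suc n)) _ ⟨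
  a ℤ.* (f 0 ℤ.* g (suc n) ℤ.+ (tail f ⊛ g) n)
    ≡⟨ cong (a ℤ.*_) (⊛-suc f g n) ⟨
  a ℤ.* (f ⊛ g) (suc n) ∎

⊛-assoc : ∀ f g h → (f ⊛ g) ⊛ h ≐ f ⊛ (g ⊛ h)
⊛-assoc f g h zero    = ℤₚ.*-assoc (f 0) (g 0) (h 0)
⊛-assoc f g h (suc n) = begin
  ((f ⊛ g) ⊛ h) (suc n)
    ≡⟨ ⊛-suc (f ⊛ g) h n ⟩
  f 0 ℤ.* g 0 ℤ.* h (suc n) ℤ.+ (tail (f ⊛ g) ⊛ h) n
    ≡⟨ cong (λ z → f 0 ℤ.* g 0 ℤ.* h (suc n) ℤ.+ z) (trans (⊛-cong {g = h} (⊛-suc f g) (λ _ → refl) n)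
         (trans (⊛-distribʳ-⊕ h (λ m → f 0 ℤ.* tail g m) (tail f ⊛ g) n)
           (cong₂ ℤ._+_ (⊛-scale (f 0) (tail g) h n) (⊛-assoc (tail f) g h n)))) ⟩
  f 0 ℤ.* g 0 ℤ.* h (suc n) ℤ.+ (f 0 ℤ.* (tail g ⊛ h) n ℤ.+ (tail f ⊛ (g ⊛ h)) n)
    ≡⟨ rearrange (f 0) (g 0) (h (suc n)) _ _ ⟩
  f 0 ℤ.* (g 0 ℤ.* h (suc n) ℤ.+ (tail g ⊛ h) n) ℤ.+ (tail f ⊛ (g ⊛ h)) n
    ≡⟨ cong (λ z → f 0 ℤ.* z ℤ.+ (tail f ⊛ (g ⊛ h)) n) (⊛-suc g h n) ⟨
  f 0 ℤ.* (g ⊛ h) (suc n) ℤ.+ (tail f ⊛ (g ⊛ h)) n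
    ≡⟨ ⊛-suc f (g ⊛ h) n ⟨
  (f ⊛ (g ⊛ h)) (suc n) ∎
  where
  rearrange : ∀ a b c d e → a ℤ.* b ℤ.* c ℤ.+ (a ℤ.* d ℤ.+ e) ≡ a ℤ.* (b ℤ.* c ℤ.+ d) ℤ.+ e
  rearrange = solve-∀

≐-isEquivalence : IsEquivalence _≐_
≐-isEquivalence = record
  { refl = λ _ → refl ; sym = λ e n → sym (e n) ; trans = λ e e′ n → trans (e n) (e′ n) }

-- It serves the solver with natural coefficients; the single subtraction, in 1 - x, is treated by
-- hand.
seriesSemiring : CommutativeSemiring 0ℓ 0ℓ
seriesSemiring = record
  { Carrier = Series ; _≈_ = _≐_ ; _+_ = _⊕_ ; _*_ = _⊛_ ; 0# = 𝟘 ; 1# = 𝟙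
  ; isCommutativeSemiring = Biased.isCommutativeSemiringˡ record
    { +-isCommutativeMonoid = Biased.isCommutativeMonoidˡ record
      { isSemigroup = record
        { isMagma = record { isEquivalence = ≐-isEquivalence ; ∙-cong = λ e e′ n → cong₂ ℤ._+_ (e n) (e′ n) }
        ; assoc   = λ f g h n → ℤₚ.+-assoc (f n) (g n) (h n) }
      ; identityˡ = λ f n → ℤₚ.+-identityˡ (f n)
      ; comm      = λ f g n → ℤₚ.+-comm (f n) (g n) }
    ; *-isCommutativeMonoid = Biased.isCommutativeMonoidˡ record
      { isSemigroup = record
        { isMagma = record { isEquivalence = ≐-isEquivalence ; ∙-cong = ⊛-cong }
        ; assoc   = ⊛-assoc }
      ; identityˡ = ⊛-identityˡ
      ; comm      = ⊛-comm }
    ; distribʳ = ⊛-distribʳ-⊕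
    ; zeroˡ    = ⊛-zeroˡ }
  }

X⊛-zero : ∀ f → (X ⊛ f) 0 ≡ + 0
X⊛-zero f = ℤₚ.*-zeroˡ (f 0)

X⊛-suc : ∀ f n → (X ⊛ f) (suc n) ≡ f n
X⊛-suc f n = trans (⊛-suc X f n)
  (trans (cong₂ ℤ._+_ (ℤₚ.*-zeroˡ (f (suc n))) (trans (⊛-cong {g = f} tail-X (λ _ → refl) n) (⊛-identityˡ f n)))
         (ℤₚ.+-identityˡ (f n)))
  where
  tail-X : tail X ≐ 𝟙
  tail-X zero    = refl
  tail-X (suc n) = refl

mono-suc : ∀ a e → mono a (suc e) ≐ X ⊛ mono a e
mono-suc a e zero    = sym (X⊛-zero (mono a e))
mono-suc a e (suc n) = sym (X⊛-suc (mono a e) n)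

mono-+ : ∀ a b e → mono (a ℤ.+ b) e ≐ mono a e ⊕ mono b e
mono-+ a b e n with does (n ℕ.≟ e)
... | true  = refl
... | false = refl

mono⊛-low : ∀ a f {e n} → n < e → (mono a e ⊛ f) n ≡ + 0
mono⊛-low a f {suc e} {zero}  _         = ℤₚ.*-zeroˡ (f 0)
mono⊛-low a f {suc e} {suc n} (s≤s n<e) =
  trans (⊛-suc (mono a (suc e)) f n) (cong₂ ℤ._+_ (ℤₚ.*-zeroˡ (f (suc n))) (mono⊛-low a f n<e))

open CommutativeSemiring seriesSemiring
  using () renaming (setoid to seriesSetoid; refl to ≐-refl; sym to ≐-sym; trans to ≐-trans; +-cong to ⊕-cong)

open SemiringSolver seriesSemiring using (solve; con; _:+_; _:*_; _:=_)

-- Generating functions of the counts and the infinite products.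

⟦_⟧ : (ℕ → ℕ) → Series
⟦ f ⟧ n = + f n

⟦δ⟧ : ⟦ δ ⟧ ≐ 𝟙
⟦δ⟧ zero    = refl
⟦δ⟧ (suc n) = refl

⟦delay⟧ : ∀ s f → ⟦ delay s f ⟧ ≐ mono (+ 1) s ⊛ ⟦ f ⟧
⟦delay⟧ zero    f n = sym (⊛-identityˡ ⟦ f ⟧ n)
⟦delay⟧ (suc s) f n = trans (go n) (sym (trans (⊛-cong {g = ⟦ f ⟧} (mono-suc (+ 1) s) (λ _ → refl) n) (⊛-assoc X (mono (+ 1) s) ⟦ f ⟧ n)))
  where
  go : ⟦ delay (suc s) f ⟧ ≐ X ⊛ (mono (+ 1) s ⊛ ⟦ f ⟧)
  go zero    = sym (X⊛-zero (mono (+ 1) s ⊛ ⟦ f ⟧))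
  go (suc n) = trans (⟦delay⟧ s f n) (sym (X⊛-suc (mono (+ 1) s ⊛ ⟦ f ⟧) n))

mono2 : ∀ e → mono (+ 2) e ≐ mono (+ 1) e ⊕ mono (+ 1) e
mono2 = mono-+ (+ 1) (+ 1)

mono4 : mono (+ 4) 1 ≐ (X ⊕ X) ⊕ (X ⊕ X)
mono4 = ≐-trans (mono-+ (+ 2) (+ 2) 1) (⊕-cong (mono2 1) (mono2 1))

-- e stands for x^(2^k − 1), so that x^(2^k) = x e.
factor-split : ∀ k → let e = mono (+ 1) (2 ^ k ∸ 1) in factor k ≐ (𝟙 ⊕ e) ⊕ (X ⊛ e ⊕ X ⊛ e)
factor-split k = ⊕-cong {x = 𝟙 ⊕ mono (+ 1) (2 ^ k ∸ 1)} (λ _ → refl) (≐-trans (mono2 (2 ^ k)) (⊕-cong shift shift))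
  where
  shift : mono (+ 1) (2 ^ k) ≐ X ⊛ mono (+ 1) (2 ^ k ∸ 1)
  shift with 2 ^ k | m^n>0 2 k
  ... | suc m | _ = mono-suc (+ 1) m

⟦cornerSize⟧ : ∀ f → ⟦ cornerSize f ⟧ ≐ 𝟙 ⊕ (X ⊕ (X ⊛ ⟦ f ⟧ ⊕ (X ⊛ ⟦ f ⟧ ⊕ ⟦ f ⟧)))
⟦cornerSize⟧ f n = cong₂ ℤ._+_ (⟦δ⟧ n) (cong₂ ℤ._+_ (x n) (cong₂ ℤ._+_ (⟦delay⟧ 1 f n) (cong (ℤ._+ + f n) (⟦delay⟧ 1 f n))))
  where
  x : ⟦ delay 1 δ ⟧ ≐ X
  x zero          = refl
  x (suc zero)    = refl
  x (suc (suc n)) = refl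

⟦toothSize⟧ : ∀ f → ⟦ toothSize f ⟧ ≐
  𝟙 ⊕ (X ⊕ (X ⊕ (X ⊛ ⟦ f ⟧ ⊕ (X ⊛ ⟦ f ⟧ ⊕ (X ⊛ ⟦ f ⟧ ⊕ X ⊛ ⟦ f ⟧)))))
⟦toothSize⟧ f n = cong₂ ℤ._+_ (⟦δ⟧ n) (cong₂ ℤ._+_ (x n) (cong₂ ℤ._+_ (x n)
  (cong₂ ℤ._+_ d (cong₂ ℤ._+_ d (cong₂ ℤ._+_ d d)))))
  where
  d = ⟦delay⟧ 1 f n
  x : ⟦ delay 1 δ ⟧ ≐ X
  x zero          = refl
  x (suc zero)    = refl
  x (suc (suc n)) = refl

-- With e = x^(2^(k+1) - 1), the corner series is affine in the block series with slope 1 + 2x.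
-- Growth adds e W to the block, hence (1 + 2x) e W to W, and 1 + (1 + 2x) e is the next factor.
⟦cornerSize-quad⟧ : ∀ k → ⟦ cornerSize (quadSize k) ⟧ ≐ (𝟙 ⊕ X) ⊛ prodRange factor 1 k
⟦cornerSize-quad⟧ zero = ≐-trans (⟦cornerSize⟧ (quadSize 0))
  (solve 1 (λ x → con 1 :+ (x :+ (x :* con 0 :+ (x :* con 0 :+ con 0))) := (con 1 :+ x) :* con 1) ≐-refl X)

⟦cornerSize-quad⟧ (suc k) =
  ≐-trans (⟦cornerSize⟧ (quadSize (suc k)))
  (≐-trans (⊕-cong {x = 𝟙} ≐-refl (⊕-cong {x = X} ≐-refl (⊕-cong (⊛-cong {X} ≐-refl N′≐) (⊕-cong (⊛-cong {X} ≐-refl N′≐) N′≐))))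
  (≐-trans (step X N e)
  (≐-trans (⊛-cong (≐-sym (⟦cornerSize⟧ (quadSize k))) (≐-sym (factor-split (suc k))))
  (≐-trans (⊛-cong (⟦cornerSize-quad⟧ k) (≐-refl {factor (suc k)}))
           (⊛-assoc (𝟙 ⊕ X) (prodRange factor 1 k) (factor (suc k)))))))
  where
  N = ⟦ quadSize k ⟧
  e = mono (+ 1) (2 ^ suc k ∸ 1)
  N′≐ : ⟦ quadSize (suc k) ⟧ ≐ N ⊕ e ⊛ (𝟙 ⊕ (X ⊕ (X ⊛ N ⊕ (X ⊛ N ⊕ N))))
  N′≐ = ⊕-cong {x = N} ≐-refl
    (≐-trans (⟦delay⟧ _ (cornerSize (quadSize k)))
             (⊛-cong (λ n → cong (λ m → mono (+ 1) (pred m) n) (cong (λ m → 2 ^ k ℕ.+ m) (sym (+-identityʳ (2 ^ k)))))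
                     (⟦cornerSize⟧ (quadSize k))))
  step : ∀ x n e →
    𝟙 ⊕ (x ⊕ (x ⊛ (n ⊕ e ⊛ (𝟙 ⊕ (x ⊕ (x ⊛ n ⊕ (x ⊛ n ⊕ n))))) ⊕
      (x ⊛ (n ⊕ e ⊛ (𝟙 ⊕ (x ⊕ (x ⊛ n ⊕ (x ⊛ n ⊕ n))))) ⊕ (n ⊕ e ⊛ (𝟙 ⊕ (x ⊕ (x ⊛ n ⊕ (x ⊛ n ⊕ n))))))))
    ≐ (𝟙 ⊕ (x ⊕ (x ⊛ n ⊕ (x ⊛ n ⊕ n)))) ⊛ ((𝟙 ⊕ e) ⊕ (x ⊛ e ⊕ x ⊛ e))
  step = solve 3 (λ x n e →
    let w = con 1 :+ (x :+ (x :* n :+ (x :* n :+ n))) ; n′ = n :+ e :* w in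
    con 1 :+ (x :+ (x :* n′ :+ (x :* n′ :+ n′))) := w :* ((con 1 :+ e) :+ (x :* e :+ x :* e))) ≐-refl

-- The diagonal is the limit: each factor beyond the first `n` differs from 1 only in degrees above
-- `n`.
P₁ P₀ : Series
P₁ n = prodRange factor 1 n n
P₀ = factor 0 ⊛ P₁

-- The factor is 1 + e (1 + 2x) with e = x^(2^k - 1), so the correction to `f` is divisible by e.
⊛-factor-low : ∀ f k {n} → n < 2 ^ k ∸ 1 → (f ⊛ factor k) n ≡ f n
⊛-factor-low f k {n} n< = begin
  (f ⊛ factor k) n                               ≡⟨ ⊛-cong {f} ≐-refl (factor-split k) n ⟩
  (f ⊛ ((𝟙 ⊕ e) ⊕ (X ⊛ e ⊕ X ⊛ e))) n            ≡⟨ expand X e f n ⟩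
  f n ℤ.+ (e ⊛ (f ⊛ (𝟙 ⊕ (X ⊕ X)))) n            ≡⟨ cong (λ z → f n ℤ.+ z) (mono⊛-low (+ 1) (f ⊛ (𝟙 ⊕ (X ⊕ X))) n<) ⟩
  f n ℤ.+ + 0                                    ≡⟨ ℤₚ.+-identityʳ (f n) ⟩
  f n                                            ∎
  where
  e = mono (+ 1) (2 ^ k ∸ 1)
  expand : ∀ x e f → f ⊛ ((𝟙 ⊕ e) ⊕ (x ⊛ e ⊕ x ⊛ e)) ≐ f ⊕ e ⊛ (f ⊛ (𝟙 ⊕ (x ⊕ x)))
  expand = solve 3 (λ x e f →
    f :* ((con 1 :+ e) :+ (x :* e :+ x :* e)) := f :+ e :* (f :* (con 1 :+ (x :+ x)))) ≐-refl

prodRange-stable : ∀ d n → prodRange factor 1 (d ℕ.+ n) n ≡ P₁ n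
prodRange-stable zero    n = refl
prodRange-stable (suc d) n = trans
  (⊛-factor-low (prodRange factor 1 (d ℕ.+ n)) (suc (d ℕ.+ n)) (ℕₚ.∸-monoˡ-≤ 1 (ℕₚ.≤-<-trans (s≤s (ℕₚ.m≤n+m n d)) (n<2^n (suc (d ℕ.+ n))))))
  (prodRange-stable d n)

P₁-stable : ∀ {m n} → n ≤ m → prodRange factor 1 m n ≡ P₁ n
P₁-stable {m} {n} n≤m =
  trans (cong (λ j → prodRange factor 1 j n) (sym (ℕₚ.m∸n+n≡m n≤m))) (prodRange-stable (m ∸ n) n)

P₁-isInfProd : IsInfProd factor 1 P₁
P₁-isInfProd n = n , λ m n≤m → P₁-stable n≤m

prodRange₀ : ∀ m → prodRange factor 0 (suc m) ≐ factor 0 ⊛ prodRange factor 1 m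
prodRange₀ zero    = ⊛-comm 𝟙 (factor 0)
prodRange₀ (suc m) = ≐-trans (⊛-cong (prodRange₀ m) (≐-refl {factor (suc m)}))
                             (⊛-assoc (factor 0) (prodRange factor 1 m) (factor (suc m)))

P₀-isInfProd : IsInfProd factor 0 P₀
P₀-isInfProd n = suc n , λ { (suc m) (s≤s n≤m) → trans (prodRange₀ m n)
  (⊛-cong-upTo (factor 0) n λ i i≤n → P₁-stable (≤-trans i≤n n≤m)) }

-- The three identities.

N W : Series
N = ⟦ quadrantSize ⟧
W = ⟦ cornerSize quadrantSize ⟧

delay-cong-upTo : ∀ s {f g} n → (∀ i → i ≤ n → f i ≡ g i) → delay s f n ≡ delay s g n
delay-cong-upTo zero    n       e = e n ≤-refl
delay-cong-upTo (suc s) zero    e = refl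
delay-cong-upTo (suc s) (suc n) e = delay-cong-upTo s n λ i i≤n → e i (≤-trans i≤n (ℕₚ.n≤1+n n))

-- Up to degree `n` the limit count agrees with block `n`, and `P₁` with the product of the first
-- `n` factors.
W≐ : W ≐ (𝟙 ⊕ X) ⊛ P₁
W≐ n = begin
  + cornerSize quadrantSize n            ≡⟨ cong (λ m → + (δ n ℕ.+ (delay 1 δ n ℕ.+ m)))
                                              (cong₂ ℕ._+_ (d 1) (cong₂ ℕ._+_ (d 1) (d 0))) ⟩
  + cornerSize (quadSize n) n            ≡⟨ ⟦cornerSize-quad⟧ n n ⟩
  ((𝟙 ⊕ X) ⊛ prodRange factor 1 n) n     ≡⟨ ⊛-cong-upTo (𝟙 ⊕ X) n (λ i i≤n → P₁-stable i≤n) ⟩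
  ((𝟙 ⊕ X) ⊛ P₁) n                       ∎
  where
  d : ∀ s → delay s quadrantSize n ≡ delay s (quadSize n) n
  d s = delay-cong-upTo s n λ i i≤n → quadrantSize≡ i≤n

cGF≐ : cGF ≐ X ⊛ W
cGF≐ zero    = sym (X⊛-zero W)
cGF≐ (suc n) = trans (cong +_ (c-suc n)) (sym (X⊛-suc W n))

tGF≐ : tGF ≐ X ⊛ ⟦ toothSize quadrantSize ⟧
tGF≐ zero    = sym (X⊛-zero ⟦ toothSize quadrantSize ⟧)
tGF≐ (suc n) = trans (cong +_ (t-suc n)) (sym (X⊛-suc ⟦ toothSize quadrantSize ⟧ n))

-- Elimination of N: (1 + 2x)(1 + 2x + 4x N) = 1 + 4x (1 + x + (1 + 2x) N), and the last bracket is
-- W.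
tGF-P₁ : (𝟙 ⊕ mono (+ 2) 1) ⊛ tGF ≐ X ⊛ (𝟙 ⊕ mono (+ 4) 1 ⊛ (𝟙 ⊕ X) ⊛ P₁)
tGF-P₁ =
  ≐-trans (⊛-cong (⊕-cong {x = 𝟙} ≐-refl (mono2 1)) (≐-trans tGF≐ (⊛-cong {X} ≐-refl (⟦toothSize⟧ quadrantSize))))
  (≐-trans (algebra X N)
  (⊛-cong {X} ≐-refl (⊕-cong {x = 𝟙} ≐-refl
    (≐-trans (⊛-cong (≐-sym mono4) (≐-trans (≐-sym (⟦cornerSize⟧ quadrantSize)) W≐))
             (≐-sym (⊛-assoc (mono (+ 4) 1) (𝟙 ⊕ X) P₁))))))
  where
  algebra : ∀ x n → (𝟙 ⊕ (x ⊕ x)) ⊛ (x ⊛ (𝟙 ⊕ (x ⊕ (x ⊕ (x ⊛ n ⊕ (x ⊛ n ⊕ (x ⊛ n ⊕ x ⊛ n)))))))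
                  ≐ x ⊛ (𝟙 ⊕ ((x ⊕ x) ⊕ (x ⊕ x)) ⊛ (𝟙 ⊕ (x ⊕ (x ⊛ n ⊕ (x ⊛ n ⊕ n)))))
  algebra = solve 2 (λ x n →
    (con 1 :+ (x :+ x)) :* (x :* (con 1 :+ (x :+ (x :+ (x :* n :+ (x :* n :+ (x :* n :+ x :* n)))))))
    := x :* (con 1 :+ ((x :+ x) :+ (x :+ x)) :* (con 1 :+ (x :+ (x :* n :+ (x :* n :+ n)))))) ≐-refl

-- The factor at index 0 is 1 + x^0 + 2x = 2 (1 + x), which absorbs half of the 4 and the 1 + x.
P₁-P₀ : mono (+ 4) 1 ⊛ (𝟙 ⊕ X) ⊛ P₁ ≐ mono (+ 2) 1 ⊛ P₀
P₁-P₀ =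
  ≐-trans (⊛-cong {g = P₁} (⊛-cong {g = 𝟙 ⊕ X} mono4 ≐-refl) ≐-refl)
  (≐-trans (algebra X P₁)
  (⊛-cong (≐-sym (mono2 1)) (⊛-cong {g = P₁} (⊕-cong {x = 𝟙 ⊕ 𝟙} ≐-refl (≐-sym (mono2 1))) ≐-refl)))
  where
  algebra : ∀ x p → ((x ⊕ x) ⊕ (x ⊕ x)) ⊛ (𝟙 ⊕ x) ⊛ p ≐ (x ⊕ x) ⊛ (((𝟙 ⊕ 𝟙) ⊕ (x ⊕ x)) ⊛ p)
  algebra = solve 2 (λ x p →
    ((x :+ x) :+ (x :+ x)) :* (con 1 :+ x) :* p := (x :+ x) :* (((con 1 :+ con 1) :+ (x :+ x)) :* p)) ≐-refl

tGF-P₀ : (𝟙 ⊕ mono (+ 2) 1) ⊛ tGF ≐ X ⊛ (𝟙 ⊕ mono (+ 2) 1 ⊛ P₀)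
tGF-P₀ = ≐-trans tGF-P₁ (⊛-cong {X} ≐-refl (⊕-cong {x = 𝟙} ≐-refl P₁-P₀))

-- Partial sums satisfy TGF = tGF + x TGF; adding x TGF to both sides of the claim turns it into
-- this recurrence.
𝟙⊖X⊛TGF : (𝟙 ⊖ X) ⊛ TGF ≐ tGF
𝟙⊖X⊛TGF n = ∙-cancelʳ ((X ⊛ TGF) n) _ _ (trans (sum n) (TGF-rec n))
  where
  sum : (𝟙 ⊖ X) ⊛ TGF ⊕ X ⊛ TGF ≐ TGF
  sum = ≐-trans (≐-sym (⊛-distribʳ-⊕ TGF (𝟙 ⊖ X) X))
          (≐-trans (⊛-cong {g = TGF} (λ n → minus-plus (𝟙 n) (X n)) ≐-refl) (⊛-identityˡ TGF))
    where
    minus-plus : ∀ a b → a ℤ.- b ℤ.+ b ≡ a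
    minus-plus a b = trans (ℤₚ.+-assoc a (ℤ.- b) b) (trans (cong (λ z → a ℤ.+ z) (ℤₚ.+-inverseˡ b)) (ℤₚ.+-identityʳ a))
  TGF-rec : ∀ n → TGF n ≡ tGF n ℤ.+ (X ⊛ TGF) n
  TGF-rec zero    = sym (cong (λ z → + 0 ℤ.+ z) (X⊛-zero TGF))
  TGF-rec (suc n) = trans (ℤₚ.+-comm (TGF n) (tGF (suc n))) (cong (λ z → tGF (suc n) ℤ.+ z) (sym (X⊛-suc TGF n)))

theorem7 : Σ Series λ P₁ → Σ Series λ P₀ →
    IsInfProd factor 1 P₁ × IsInfProd factor 0 P₀ ×
    (cGF ≐ X ⊛ (𝟙 ⊕ X) ⊛ P₁) ×
    ((𝟙 ⊕ mono (+ 2) 1) ⊛ tGF ≐ X ⊛ (𝟙 ⊕ mono (+ 4) 1 ⊛ (𝟙 ⊕ X) ⊛ P₁)) ×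
    ((𝟙 ⊕ mono (+ 2) 1) ⊛ tGF ≐ X ⊛ (𝟙 ⊕ mono (+ 2) 1 ⊛ P₀)) ×
    ((𝟙 ⊖ X) ⊛ (𝟙 ⊕ mono (+ 2) 1) ⊛ TGF ≐ X ⊛ (𝟙 ⊕ mono (+ 2) 1 ⊛ P₀))
theorem7 = P₁ , P₀ , P₁-isInfProd , P₀-isInfProd
  , ≐-trans cGF≐ (≐-trans (⊛-cong {X} ≐-refl W≐) (≐-sym (⊛-assoc X (𝟙 ⊕ X) P₁)))
  , tGF-P₁
  , tGF-P₀
  , ≐-trans (⊛-cong {g = TGF} (⊛-comm (𝟙 ⊖ X) (𝟙 ⊕ mono (+ 2) 1)) ≐-refl)
    (≐-trans (⊛-assoc (𝟙 ⊕ mono (+ 2) 1) (𝟙 ⊖ X) TGF)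
    (≐-trans (⊛-cong {𝟙 ⊕ mono (+ 2) 1} ≐-refl 𝟙⊖X⊛TGF) tGF-P₀))
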